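{- Let $n\ge 1$ and let $\alpha$ be a composition. The quasiGrothendieck polynomial $\overline{S}_\alpha=\overline{S}_\alpha^{(\beta)}(x_1,\dots,x_n)\in \mathrm{QSym}_n[\beta]$ is a positive sum of multifundamental quasisymmetric polynomials; that is, \[ \overline{S}_\alpha=\sum_\gamma J^\alpha_\gamma\,\overline{F}_\gamma , \] where the (finite) sum is over compositions $\gamma$, $\overline{F}_\gamma=\overline{F}_\gamma^{(\beta)}(x_1,\dots,x_n)$, and each $J^\alpha_\gamma\in\mathbb{Z}_{\ge 0}[\beta]$ is a polynomial in $\beta$ with nonnegative integer coefficients.
   Context: Fix $n\ge1$; $\beta$ is a formal parameter. A weak composition of length $n$ is a sequence $a=(a_1,\dots,a_n)$ of nonnegative integers, $|a|=\sum_i a_i$, and $\mathbf{x}^a=x_1^{a_1}\cdots x_n^{a_n}$. A composition is a finite sequence of positive integers. The positive part $a^+$ of $a$ is the composition obtained by deleting all zeros of $a$. $\mathrm{QSym}_n\subset\mathbb{Z}[x_1,\dots,x_n]$ denotes the quasisymmetric polynomials. Lascoux atoms. The skyline diagram $D(a)$ has $a_i$ left-justified boxes in row $i$; row $1$ is the lowest row. A triple consists of three boxes, two of them adjacent in a row (left box with entry $\beta'$, right box with entry $\alpha'$) and a third box with entry $\gamma'$, such that either (Type A) the third box is above the right box, in the same column as it, and the lower of the two rows is weakly longer, or (Type B) the third box is below the left box, in the same column as it, and the higher of the two rows is strictly longer. A triple is an inversion triple if $\gamma'<\alpha'\le\beta'$ or $\alpha'\le\beta'<\gamma'$. A set-valued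 filling assigns a nonempty set of positive integers to each box; the maximum of each box is its anchor, all other entries are free. It is semistandard if (S.1) entries do not repeat in a column; (S.2) rows are weakly decreasing from left to right, where $A\ge B$ means $\min A\ge\max B$; (S.3) every triple of anchors is an inversion triple; (S.4) each free entry is in the cell of the least anchor in its column such that (S.2) is not violated (i.e. among the cells of its column with larger anchor in which it could be placed without violating (S.2), it is in the one with least anchor); (S.5) anchors in the first column equal their row index. Let $\overline{\mathfrak{A}}\mathsf{SSF}(a)$ be the set of semistandard set-valued fillings of $D(a)$. For a filling $F$, $\mathrm{wt}(F)=(c_1,\dots,c_n)$ with $c_i$ the number of $i$'s in $F$, and $\mathrm{ex}(F)$ is the number of free entries. The Lascoux atom is $\overline{\mathfrak{A}}_a^{(\beta)}=\sum_{F\in\overline{\mathfrak{A}}\mathsf{SSF}(a)}\beta^{\mathrm{ex}(F)}\mathbf{x}^{\mathrm{wt}(F)}$. QuasiGrothendieck polynomials. $\overline{S}_\alpha^{(\beta)}(x_1,\dots,x_n)=\sum_{a^+=\alpha}\overline{\mathfrak{A}}_a^{(\beta)}$, the sum over weak compositions $a$ of length $n$ with $a^+=\alpha$. Multifundamental quasisymmetric polynomials. A weak komposition is a weak composition whose positive entries are each colored black or red (different colorings are different weak kompositions); its excess $\mathrm{ex}$ is the number of red entries. For a weak composition $a$ of length $n$ with nonzero entries exactly in positions $n_1<\dots<n_\ell$, a weak komposition $b$ of length $n$ is a glide of $a$ if there exist integers $0=i_0<i_1<\dots<i_\ell$ such that $b_k=0$ for $k>i_\ell$ and, for each $1\le j\le\ell$: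 $a_{n_j}=b_{i_{j-1}+1}+\dots+b_{i_j}-\mathrm{ex}(b_{i_{j-1}+1},\dots,b_{i_j})$; $i_j\le n_j$; and the leftmost nonzero entry among $b_{i_{j-1}+1},\dots,b_{i_j}$ is black. The glide polynomial is $\overline{\mathfrak{F}}_a^{(\beta)}=\sum_b\beta^{\mathrm{ex}(b)}\mathbf{x}^b$ over all glides $b$ of $a$. For a composition $\gamma$ with $\ell(\gamma)\le n$ parts, the multifundamental quasisymmetric polynomial is $\overline{F}_\gamma^{(\beta)}(x_1,\dots,x_n)=\overline{\mathfrak{F}}^{(\beta)}_{(0,\dots,0,\gamma_1,\dots,\gamma_{\ell(\gamma)})}$, with $n-\ell(\gamma)$ leading zeros; it is $0$ if $\ell(\gamma)>n$. -}

module Defs where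

open import Data.Bool.Base using (if_then_else_)
open import Data.Fin.Base as Fin using (Fin; toℕ)
import Data.Fin.Properties as Fin
open import Data.Fin.Subset
  using (Subset; _∈_; _∪_; _-_; ⁅_⁆; inside; outside; Nonempty)
open import Data.Fin.Subset.Properties using (_∈?_; nonempty?)
open import Data.Integer.Base as ℤ using (ℤ; 0ℤ; 1ℤ)
open import Data.List.Base as List
  using (List; []; _∷_; length; map; filter; concatMap; upTo; allFin;
         cartesianProduct; cartesianProductWith)
import Data.List.Properties as List
import Data.List.Relation.Unary.All as ListAll
open import Data.Nat.Base
  using (ℕ; zero; suc; _+_; _∸_; _≤_; _<_; z≤n; s≤s; s≤s⁻¹)
open import Data.Nat.ListAction using (sum)
open import Data.Nat.Properties using (_≟_; _≤?_; _<?_; anyUpTo?; m∸n+n≡m)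
open import Data.Product.Base using (∃; _×_; _,_; proj₁; proj₂)
import Data.Product.Properties as Product
open import Data.Sum.Base using (_⊎_)
open import Data.Vec.Base as Vec using (Vec; []; _∷_; lookup)
import Data.Vec.Properties as Vec
open import Data.Vec.Relation.Unary.All as VecAll using ([]; _∷_)
open import Data.Vec.Relation.Unary.All.Properties using (lookup⁺)
open import Relation.Binary.Definitions using (DecidableEquality)
open import Relation.Binary.PropositionalEquality using (_≡_; _≢_; refl; cong)
open import Relation.Nullary.Decidable
  using (Dec; yes; no; does; map′; ¬?; _×-dec_; _⊎-dec_; _→-dec_)
open import Relation.Nullary.Negation using (¬_)
open import Relation.Unary using (Decidable)

vectors : {A : Set} → List A → (k : ℕ) → List (Vec A k)
vectors xs zero    = [] ∷ []
vectors xs (suc k) = cartesianProductWith _∷_ xs (vectors xs k)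

-- All tables of shape `a` (row i has length aᵢ) with cells from a given list.
tables : {A : Set} {m : ℕ} → List A → (a : Vec ℕ m) → List (VecAll.All (Vec A) a)
tables xs []      = [] ∷ []
tables xs (k ∷ a) = cartesianProductWith _∷_ (vectors xs k) (tables xs a)

-- c · β^k · x^e
record Term (n : ℕ) : Set where
  constructor term
  field
    coefficient : ℤ
    βExponent   : ℕ
    xExponent   : Vec ℕ n

-- Polynomials are finite formal sums of terms, compared with _≈_ below.
Poly : ℕ → Set
Poly n = List (Term n)

module _ {n : ℕ} where

  coeff : Poly n → ℕ → Vec ℕ n → ℤ
  coeff []                k e = 0ℤ
  coeff (term c k′ e′ ∷ p) k e =
    (if does (k′ ≟ k ×-dec Vec.≡-dec _≟_ e′ e) then c else 0ℤ) ℤ.+ coeff p k e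

  infix 4 _≈_
  _≈_ : Poly n → Poly n → Set
  p ≈ q = ∀ k e → coeff p k e ≡ coeff q k e

-- ℤ≥0[β]: the entry at position k is the coefficient of β^k.
ℕ[β] : Set
ℕ[β] = List ℕ

infixr 7 _·_
_·_ : {n : ℕ} → ℕ[β] → Poly n → Poly n
[]      · p = []
(c ∷ J) · p =
  map (λ (term d k e) → term (ℤ.+ c ℤ.* d) k e) p List.++
  map (λ (term d k e) → term d (suc k) e) (J · p)

sumOver : {A : Set} {n : ℕ} → List A → (A → Poly n) → Poly n
sumOver xs f = concatMap f xs

IsComposition : List ℕ → Set
IsComposition = ListAll.All (0 <_)

positivePart : {n : ℕ} → Vec ℕ n → List ℕ
positivePart a = filter (0 <?_) (Vec.toList a)

-- Membership in QSymₙ[β]: the coefficient of x^a depends only on a⁺.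
IsQuasisymmetric : {n : ℕ} → Poly n → Set
IsQuasisymmetric {n} p = ∀ k (a b : Vec ℕ n) →
  positivePart a ≡ positivePart b → coeff p k a ≡ coeff p k b

module _ {n : ℕ} where

  -- Here and for rows, k : Fin n stands for the positive integer toℕ k + 1.
  -- Nothing is lost by bounding the entries by n: in a semistandard filling
  -- the first box of row i has maximum i ≤ n and rows weakly decrease.
  Entry : Set
  Entry = Fin n

  IsMax IsMin : Entry → Subset n → Set
  IsMax x A = x ∈ A × (∀ y → y ∈ A → y Fin.≤ x)
  IsMin x A = x ∈ A × (∀ y → y ∈ A → x Fin.≤ y)

  isMax? : ∀ x A → Dec (IsMax x A)
  isMax? x A = x ∈? A ×-dec Fin.all? λ y → y ∈? A →-dec y Fin.≤? x

  isMin? : ∀ x A → Dec (IsMin x A)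
  isMin? x A = x ∈? A ×-dec Fin.all? λ y → y ∈? A →-dec x Fin.≤? y

  infix 4 _≽_
  _≽_ : Subset n → Subset n → Set
  A ≽ B = ∀ x y → IsMin x A → IsMax y B → y Fin.≤ x

  _≽?_ : ∀ A B → Dec (A ≽ B)
  A ≽? B = Fin.all? λ x → Fin.all? λ y →
    isMin? x A →-dec isMax? y B →-dec y Fin.≤? x

  InversionTriple : (α β γ : Entry) → Set
  InversionTriple α β γ =
    (γ Fin.< α × α Fin.≤ β) ⊎ (α Fin.≤ β × β Fin.< γ)

  inversionTriple? : ∀ α β γ → Dec (InversionTriple α β γ)
  inversionTriple? α β γ =
    (γ Fin.<? α ×-dec α Fin.≤? β) ⊎-dec (α Fin.≤? β ×-dec β Fin.<? γ)

module Diagram {n : ℕ} (a : Vec ℕ n) where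

  Box : Set
  Box = ∃ λ (i : Fin n) → Fin (lookup a i)

  row : Box → Fin n
  row = proj₁

  -- Columns are numbered from 0.
  col : Box → ℕ
  col b = toℕ (proj₂ b)

  rowLength : Box → ℕ
  rowLength b = lookup a (row b)

  boxes : List Box
  boxes = concatMap (λ i → map (i ,_) (allFin (lookup a i))) (allFin n)

  _≟ᵇ_ : DecidableEquality Box
  _≟ᵇ_ = Product.≡-dec Fin._≟_ Fin._≟_

  allBoxes? : {P : Box → Set} → Decidable P → Dec (∀ b → P b)
  allBoxes? P? = map′ (λ f (i , c) → f i c) (λ f i c → f (i , c))
    (Fin.all? λ i → Fin.all? λ c → P? (i , c))

  Adjacent : (l r : Box) → Set
  Adjacent l r = row l ≡ row r × col r ≡ suc (col l)

  adjacent? : ∀ l r → Dec (Adjacent l r)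
  adjacent? l r = row l Fin.≟ row r ×-dec col r ≟ suc (col l)

  -- Row 1 is the lowest row, so a larger row index means higher up.
  TypeA TypeB Triple : (l r t : Box) → Set
  TypeA l r t = Adjacent l r ×
    row r Fin.< row t × col t ≡ col r × rowLength t ≤ rowLength r
  TypeB l r t = Adjacent l r ×
    row t Fin.< row l × col t ≡ col l × rowLength t < rowLength l
  Triple l r t = TypeA l r t ⊎ TypeB l r t

  triple? : ∀ l r t → Dec (Triple l r t)
  triple? l r t =
    (adjacent? l r ×-dec
      row r Fin.<? row t ×-dec col t ≟ col r ×-dec rowLength t ≤? rowLength r)
    ⊎-dec
    (adjacent? l r ×-dec
      row t Fin.<? row l ×-dec col t ≟ col l ×-dec rowLength t <? rowLength l)

  Filling : Set
  Filling = Box → Subset n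

  module _ (F : Filling) where

    Anchor Free : Box → Entry → Set
    Anchor b x = IsMax x (F b)
    Free   b x = x ∈ F b × ¬ Anchor b x

    anchor? : ∀ b x → Dec (Anchor b x)
    anchor? b x = isMax? x (F b)

    free? : ∀ b x → Dec (Free b x)
    free? b x = x ∈? F b ×-dec ¬? (anchor? b x)

    S1 S2 S3 S5 : Set
    S1 = ∀ b b′ → col b ≡ col b′ → b ≢ b′ → ∀ x → ¬ (x ∈ F b × x ∈ F b′)
    S2 = ∀ l r → Adjacent l r → F l ≽ F r
    S3 = ∀ l r t → Triple l r t → ∀ α β γ →
         Anchor r α → Anchor l β → Anchor t γ → InversionTriple α β γ
    S5 = ∀ b → col b ≡ 0 → ∀ x → Anchor b x → x ≡ row b

  move : Filling → Entry → (b b′ : Box) → Filling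
  move F x b b′ d = if does (d ≟ᵇ b′) then removed ∪ ⁅ x ⁆ else removed
    where
    removed : Subset n
    removed = if does (d ≟ᵇ b) then F d - x else F d

  -- A free entry x of b sits under the least anchor z among the boxes b′ of
  -- its column that have anchor z > x and can receive x without violating S2.
  S4 : Filling → Set
  S4 F = ∀ b x → Free F b x → ∀ b′ → col b′ ≡ col b →
         ∀ y z → Anchor F b y → Anchor F b′ z →
         x Fin.< z → S2 (move F x b b′) → y Fin.≤ z

  record Semistandard (F : Filling) : Set where
    field
      nonempty : ∀ b → Nonempty (F b)
      s1       : S1 F
      s2       : S2 F
      s3       : S3 F
      s4       : S4 F
      s5       : S5 F

  s1? : ∀ F → Dec (S1 F)
  s1? F = allBoxes? λ b → allBoxes? λ b′ →
    col b ≟ col b′ →-dec ¬? (b ≟ᵇ b′) →-dec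
    Fin.all? λ x → ¬? (x ∈? F b ×-dec x ∈? F b′)

  s2? : ∀ F → Dec (S2 F)
  s2? F = allBoxes? λ l → allBoxes? λ r → adjacent? l r →-dec F l ≽? F r

  s3? : ∀ F → Dec (S3 F)
  s3? F = allBoxes? λ l → allBoxes? λ r → allBoxes? λ t → triple? l r t →-dec
    Fin.all? λ α → Fin.all? λ β → Fin.all? λ γ →
    anchor? F r α →-dec anchor? F l β →-dec anchor? F t γ →-dec
    inversionTriple? α β γ

  s4? : ∀ F → Dec (S4 F)
  s4? F = allBoxes? λ b → Fin.all? λ x → free? F b x →-dec
    allBoxes? λ b′ → col b′ ≟ col b →-dec
    Fin.all? λ y → Fin.all? λ z → anchor? F b y →-dec anchor? F b′ z →-dec
    x Fin.<? z →-dec s2? (move F x b b′) →-dec y Fin.≤? z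

  s5? : ∀ F → Dec (S5 F)
  s5? F = allBoxes? λ b → col b ≟ 0 →-dec
    Fin.all? λ x → anchor? F b x →-dec x Fin.≟ row b

  semistandard? : Decidable Semistandard
  semistandard? F = map′
    (λ (h₀ , h₁ , h₂ , h₃ , h₄ , h₅) → record
      { nonempty = h₀ ; s1 = h₁ ; s2 = h₂ ; s3 = h₃ ; s4 = h₄ ; s5 = h₅ })
    (λ h → let open Semistandard h in nonempty , s1 , s2 , s3 , s4 , s5)
    (allBoxes? (λ b → nonempty? (F b)) ×-dec
      s1? F ×-dec s2? F ×-dec s3? F ×-dec s4? F ×-dec s5? F)

  ex : Filling → ℕ
  ex F = length
    (filter (λ (b , x) → free? F b x) (cartesianProduct boxes (allFin n)))

  wt : Filling → Vec ℕ n
  wt F = Vec.tabulate λ x → length (filter (λ b → x ∈? F b) boxes)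

  -- Fillings as first-order data, so that they can be listed without
  -- repetition.
  Table : Set
  Table = VecAll.All (Vec (Subset n)) a

  filling : Table → Filling
  filling T (i , c) = lookup (lookup⁺ T i) c

  SSF : List Table
  SSF = filter (λ T → semistandard? (filling T))
    (tables (vectors (outside ∷ inside ∷ []) n) a)

lascouxAtom : {n : ℕ} → Vec ℕ n → Poly n
lascouxAtom a = map (λ T → term 1ℤ (ex (filling T)) (wt (filling T))) SSF
  where open Diagram a

-- The weak compositions a of length n with a⁺ = α (all their entries are at
-- most |α|).
weakCompositions : (n : ℕ) → List ℕ → List (Vec ℕ n)
weakCompositions n α = filter (λ a → List.≡-dec _≟_ (positivePart a) α)
  (vectors (upTo (suc (sum α))) n)

quasiGrothendieck : (n : ℕ) → List ℕ → Poly n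
quasiGrothendieck n α = sumOver (weakCompositions n α) lascouxAtom

data Colour : Set where
  black red : Colour

-- An entry of a weak komposition; `coloured c m` is the positive entry m + 1.
data KEntry : Set where
  nil      : KEntry
  coloured : Colour → (m : ℕ) → KEntry

value : KEntry → ℕ
value nil            = 0
value (coloured _ m) = suc m

redness : KEntry → ℕ
redness (coloured red _) = 1
redness _                = 0

WeakKomposition : ℕ → Set
WeakKomposition n = Vec KEntry n

total excess : List KEntry → ℕ
total  bs = sum (map value bs)
excess bs = sum (map redness bs)

-- The leftmost nonzero entry exists and is black.
data LeadingBlack : List KEntry → Set where
  here : ∀ {m bs} → LeadingBlack (coloured black m ∷ bs)
  skip : ∀ {bs} → LeadingBlack bs → LeadingBlack (nil ∷ bs)

leadingBlack? : Decidable LeadingBlack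
leadingBlack? []                      = no λ ()
leadingBlack? (nil ∷ bs)              =
  map′ skip (λ { (skip h) → h }) (leadingBlack? bs)
leadingBlack? (coloured black m ∷ bs) = yes here
leadingBlack? (coloured red m ∷ bs)   = no λ ()

module Glide {n : ℕ} (a : Vec ℕ n) where

  -- The positions n₁ < ⋯ < n_ℓ of the nonzero entries of a, 0-based.
  support : List (Fin n)
  support = filter (λ p → 0 <? lookup a p) (allFin n)

  module _ (b : WeakKomposition n) where

    -- The entries b_{lo+1}, …, b_{hi} (1-based).
    block : (lo hi : ℕ) → List KEntry
    block lo hi = List.drop lo (List.take hi (Vec.toList b))

    -- GlideFrom i_{j-1} (n_j ∷ ⋯ ∷ n_ℓ ∷ []) is the existence of
    -- i_{j-1} < i_j < ⋯ < i_ℓ satisfying the glide conditions for the blocks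
    -- j, …, ℓ; `glide` supplies i_j = hi.
    data GlideFrom : (lo : ℕ) → List (Fin n) → Set where
      done  : ∀ {lo} →
              (∀ k → lo ≤ toℕ k → value (lookup b k) ≡ 0) →
              GlideFrom lo []
      glide : ∀ {lo p ps} (hi : ℕ) →
              lo < hi →
              hi ≤ suc (toℕ p) →
              lookup a p + excess (block lo hi) ≡ total (block lo hi) →
              LeadingBlack (block lo hi) →
              GlideFrom hi ps →
              GlideFrom lo (p ∷ ps)

    glideFrom? : ∀ lo ps → Dec (GlideFrom lo ps)
    glideFrom? lo []       = map′ done (λ { (done h) → h })
      (Fin.all? λ k → lo ≤? toℕ k →-dec value (lookup b k) ≟ 0)
    glideFrom? lo (p ∷ ps) = map′
      (λ (hi , hi< , lo<hi , eq , lead , rest) →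
        glide hi lo<hi (s≤s⁻¹ hi<) eq lead rest)
      (λ { (glide hi lo<hi hi≤ eq lead rest) →
        hi , s≤s hi≤ , lo<hi , eq , lead , rest })
      (anyUpTo? (λ hi → lo <? hi ×-dec
         lookup a p + excess (block lo hi) ≟ total (block lo hi) ×-dec
         leadingBlack? (block lo hi) ×-dec glideFrom? hi ps)
        (suc (suc (toℕ p))))

    IsGlide : Set
    IsGlide = GlideFrom 0 support

    isGlide? : Dec IsGlide
    isGlide? = glideFrom? 0 support

  -- The entries of a glide of a are at most |a|: in block j a black entry is
  -- at most a_{n_j}, and so is a red one v, since it contributes v - 1 on top
  -- of the at least 1 contributed by the leading black entry.
  glides : List (WeakKomposition n)
  glides = filter isGlide? (vectors (nil ∷ concatMap
    (λ m → coloured black m ∷ coloured red m ∷ []) (upTo (Vec.sum a))) n)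

glidePolynomial : {n : ℕ} → Vec ℕ n → Poly n
glidePolynomial a =
  map (λ b → term 1ℤ (excess (Vec.toList b)) (Vec.map value b)) glides
  where open Glide a

multifundamental : (n : ℕ) → List ℕ → Poly n
multifundamental n γ with length γ ≤? n
... | yes ℓ≤n = glidePolynomial
  (Vec.cast (m∸n+n≡m ℓ≤n)
    (Vec.replicate (n ∸ length γ) 0 Vec.++ Vec.fromList γ))
... | no  _   = []

{-# OPTIONS --safe #-}

-- Order the entries of a semistandard filling by value, equal entries by
-- decreasing column, and write down the word of the boxes met, recording once a
-- box that is met several times in a row. The conditions S1-S4 only compare
-- entries in the same or in adjacent columns, and such comparisons can be read
-- off from the positions in the word; S5 only says how to place the rows. So
-- semistandardness is a property of the word w. The fillings with word w arise by
-- cutting w into n column-decreasing pieces, consecutive pieces being allowed to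
-- overlap in one box; with red for the overlapping pieces, the piece lengths run
-- through the glides of the composition γ of descending run lengths of w, each
-- once, and a filling has excess that of the glide plus a constant. Hence
-- w contributes a power of β times F̄_γ.
module Submission where

open import Defs
open import Data.Bool.Base using (true; false; if_then_else_)
open import Data.Empty using (⊥)
open import Data.Fin.Base as Fin using (Fin; zero; suc; toℕ; fromℕ<)
import Data.Fin.Properties as Fin
open import Data.Fin.Subset as Subset using (Subset; _∪_; _-_; ⁅_⁆; inside; outside)
  renaming (_∈_ to _∈ₛ_)
import Data.Fin.Subset.Properties as Subset
open import Data.Integer.Base as ℤ using (0ℤ; 1ℤ)
import Data.Integer.Properties as ℤ
open import Data.Integer.Tactic.RingSolver using (solve-∀)
open import Data.List.Base as List
  using (List; []; _∷_; _++_; length; map; filter; concatMap; upTo; allFin;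
         drop; take; deduplicate; cartesianProduct)
open import Data.List.Membership.Propositional using (_∈_; _∉_; find; lose)
import Data.List.Membership.DecPropositional as DecMembership
open import Data.List.Membership.Propositional.Properties
import Data.List.Properties as List
import Data.List.Relation.Binary.Permutation.Propositional as ↭
open ↭ using (_↭_; ↭-refl; ↭-trans; ↭-sym; ↭⇒↭ₛ; prep; swap)
import Data.List.Relation.Binary.Permutation.Propositional.Properties as Perm
import Data.List.Relation.Binary.Permutation.Setoid.Properties as PermS
open import Data.List.Relation.Unary.All as All using (All; []; _∷_)
import Data.List.Relation.Unary.All.Properties as All
open import Data.List.Relation.Unary.AllPairs as AllPairs using (AllPairs; []; _∷_)
open import Data.List.Relation.Unary.Any using (here; there)
open import Data.List.Relation.Unary.Linked using (Linked; []; [-]; _∷_)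
open import Data.List.Relation.Unary.Linked.Properties using (Linked⇒AllPairs; AllPairs⇒Linked)
open import Data.List.Relation.Unary.Unique.Propositional using (Unique)
import Data.List.Relation.Unary.Unique.DecPropositional.Properties as Unique
import Data.List.Relation.Unary.Unique.Propositional.Properties as Unique
open import Data.Maybe.Base using (Maybe; just; nothing)
import Data.Maybe.Properties as Maybe
open import Data.Nat.Base
open import Data.Nat.ListAction using (sum)
open import Data.Nat.Properties
open import Data.Product.Base using (Σ; ∃; _×_; _,_; proj₁; proj₂)
import Data.Product.Properties as Product
open import Data.Sum.Base using (_⊎_; inj₁; inj₂)
open import Data.Unit.Base using (⊤; tt)
open import Data.Vec.Base as Vec using (Vec; []; _∷_; lookup)
import Data.Vec.Properties as Vec
open import Data.Vec.Relation.Unary.All as VecAll using ([]; _∷_)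
open import Data.Vec.Relation.Unary.All.Properties using (lookup⁺; lookup⁻)
open import Function.Base using (_∘_; id)
open import Relation.Binary.Definitions using (tri<; tri≈; tri>; DecidableEquality)
open import Relation.Binary.PropositionalEquality
open import Relation.Nullary.Decidable
  using (Dec; yes; no; does; map′; _×-dec_; dec-true; dec-false)
open import Relation.Nullary.Negation using (¬_; contradiction)
open import Relation.Unary using (Decidable)

-- The tie rule is dictated by the inequalities that occur. Along a row, an entry on the right must
-- be at most one on the left; the strict inequalities of triples always put the smaller entry in
-- the same column as the larger one or one column to its left. Listing equal entries from right to
-- left turns both kinds into plain precedence in the word, and S1 becomes the strict drop of
-- columns among the entries of one value. Immediate repetitions of a box are collapsed because
-- fillings with the same word differ in how many consecutive entries of a box share one occurrence;
-- repetitions at a distance stay in the word and give the constant part of the excess. The word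
-- must also forget a: another cutting changes the anchors of the first column and with them, by S5,
-- the heights of the rows. Boxes are therefore labelled by the part of α that they belong to, and
-- the argument treats the sum over all a with a⁺ = α at once, not a single atom.

-- Lists without repetition, and extrema in `Fin n`

sameMembers⇒↭ : {A : Set} {xs ys : List A} → Unique xs → Unique ys →
  (∀ {z} → z ∈ xs → z ∈ ys) → (∀ {z} → z ∈ ys → z ∈ xs) → xs ↭ ys
sameMembers⇒↭ {xs = []} {[]} _ _ _ _ = ↭-refl
sameMembers⇒↭ {xs = []} {y ∷ ys} _ _ _ ⊇ with () ← ⊇ (here refl)
sameMembers⇒↭ {xs = x ∷ xs} {ys} (x∉ ∷ u) v ⊆ ⊇
  with ys₁ , ys₂ , refl ← ∈-∃++ (⊆ (here refl)) =
  ↭-trans (prep x (sameMembers⇒↭ u v′ sub sup)) (↭-sym σ)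
  where
  σ = Perm.shift x ys₁ ys₂
  w : Unique (x ∷ ys₁ ++ ys₂)
  w = PermS.Unique-resp-↭ (setoid _) (↭⇒↭ₛ σ) v
  v′ : Unique (ys₁ ++ ys₂)
  v′ with _ ∷ r ← w = r
  x∉′ : All (x ≢_) (ys₁ ++ ys₂)
  x∉′ with r ∷ _ ← w = r
  sub : ∀ {z} → z ∈ xs → z ∈ ys₁ ++ ys₂
  sub z∈ with Perm.∈-resp-↭ σ (⊆ (there z∈))
  ... | here refl = contradiction refl (All.lookup x∉ z∈)
  ... | there z∈′ = z∈′
  sup : ∀ {z} → z ∈ ys₁ ++ ys₂ → z ∈ xs
  sup z∈ with ⊇ (Perm.∈-resp-↭ (↭-sym σ) (there z∈))
  ... | here refl = contradiction refl (All.lookup x∉′ z∈)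
  ... | there z∈′ = z∈′

-- If the heads differed, each would lie in the tail of the other list, so each would precede the
-- other.
sorted-≡ : {A : Set} {_≺_ : A → A → Set} → (∀ {x y} → x ≺ y → ¬ y ≺ x) →
  {xs ys : List A} → AllPairs _≺_ xs → AllPairs _≺_ ys →
  (∀ {z} → z ∈ xs → z ∈ ys) → (∀ {z} → z ∈ ys → z ∈ xs) → xs ≡ ys
sorted-≡ asym [] [] ⊆ ⊇ = refl
sorted-≡ asym [] (_ ∷ _) ⊆ ⊇ with () ← ⊇ (here refl)
sorted-≡ asym (_ ∷ _) [] ⊆ ⊇ with () ← ⊆ (here refl)
sorted-≡ {_≺_ = _≺_} asym {x ∷ xs} {y ∷ ys} (px ∷ pxs) (py ∷ pys) ⊆ ⊇ =
  cong₂ _∷_ x≡y (sorted-≡ asym pxs pys sub sup)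
  where
  x≡y : x ≡ y
  x≡y with ⊆ (here refl) | ⊇ (here refl)
  ... | here eq | _ = eq
  ... | there _ | here eq = sym eq
  ... | there p | there q = contradiction (All.lookup px q) (asym (All.lookup py p))
  sub : ∀ {z} → z ∈ xs → z ∈ ys
  sub z∈ with ⊆ (there z∈)
  ... | there z∈′ = z∈′
  ... | here refl = let r = subst (λ t → t ≺ _) x≡y (All.lookup px z∈) in contradiction r (asym r)
  sup : ∀ {z} → z ∈ ys → z ∈ xs
  sup z∈ with ⊇ (there z∈)
  ... | there z∈′ = z∈′
  ... | here refl = let r = subst (λ t → t ≺ _) (sym x≡y) (All.lookup py z∈) in contradiction r (asym r)

Unique-map : {A B : Set} (f : A → B) {xs : List A} →
  (∀ {x y} → x ∈ xs → y ∈ xs → f x ≡ f y → x ≡ y) → Unique xs → Unique (map f xs)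
Unique-map f inj [] = []
Unique-map f inj (x∉ ∷ u) =
  All.map⁺ (All.tabulate λ y∈ eq → All.lookup x∉ y∈ (inj (here refl) (there y∈) eq))
  ∷ Unique-map f (λ p q → inj (there p) (there q)) u

Unique-concatMap : {A B : Set} (f : A → List B) {xs : List A} →
  (∀ {x y z} → z ∈ f x → z ∈ f y → x ≡ y) →
  (∀ {x} → x ∈ xs → Unique (f x)) → Unique xs → Unique (concatMap f xs)
Unique-concatMap f disj uf [] = []
Unique-concatMap f {x ∷ xs} disj uf (x∉ ∷ u) =
  Unique.++⁺ (uf (here refl)) (Unique-concatMap f disj (uf ∘ there) u)
    λ (p , q) → let y , y∈ , z∈ = find (∈-concatMap⁻ f {xs = xs} q) in All.lookup x∉ y∈ (disj p z∈)

vectors-complete : {A : Set} (xs : List A) {k : ℕ} (v : Vec A k) →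
  (∀ i → lookup v i ∈ xs) → v ∈ vectors xs k
vectors-complete xs [] p = here refl
vectors-complete xs (x ∷ v) p =
  ∈-cartesianProductWith⁺ _∷_ (p zero) (vectors-complete xs v (p ∘ suc))

vectors-unique : {A : Set} {xs : List A} → Unique xs → ∀ k → Unique (vectors xs k)
vectors-unique u zero = [] ∷ []
vectors-unique u (suc k) =
  Unique.cartesianProductWith⁺ _∷_ (λ { refl → refl , refl }) u (vectors-unique u k)

∈-map-,⁻ : {A : Set} {B : A → Set} {x : A} {ys : List (B x)} {z : Σ A B} →
  z ∈ map (x ,_) ys → proj₁ z ≡ x
∈-map-,⁻ z∈ with _ , _ , refl ← ∈-map⁻ (_ ,_) z∈ = refl

maximum : ∀ {n} {P : Fin n → Set} → Decidable P → ∃ P → ∃ λ x → P x × (∀ y → P y → y Fin.≤ x)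
maximum {suc n} {P} P? (z , pz) with Fin.any? (P? ∘ suc)
... | yes e = let x , px , max = maximum (P? ∘ suc) e in
  suc x , px , λ { zero _ → z≤n ; (suc y) py → s≤s (max y py) }
... | no ¬e = zero , p₀ z pz , λ { zero _ → z≤n ; (suc y) py → contradiction (y , py) ¬e }
  where
  p₀ : ∀ z → P z → P zero
  p₀ zero pz = pz
  p₀ (suc z) pz = contradiction (z , pz) ¬e

minimum : ∀ {n} {P : Fin n → Set} → Decidable P → ∃ P → ∃ λ x → P x × (∀ y → P y → x Fin.≤ y)
minimum {suc n} {P} P? (z , pz) with P? zero
... | yes p = zero , p , λ _ _ → z≤n
... | no ¬p = let x , px , min = minimum (P? ∘ suc) (p₊ z pz) in
  suc x , px , λ { zero p → contradiction p ¬p ; (suc y) py → s≤s (min y py) }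
  where
  p₊ : ∀ z → P z → ∃ (P ∘ suc)
  p₊ zero pz = contradiction pz ¬p
  p₊ (suc z) pz = z , pz

-- Glides as readings of a composition

-- `total` minus `excess`, by recursion so that no truncated subtraction enters. An entry
-- `coloured red m` has value m + 1 but uses up only m of the part being read.
body : List KEntry → ℕ
body []                      = 0
body (nil ∷ bs)              = body bs
body (coloured black m ∷ bs) = suc m + body bs
body (coloured red m ∷ bs)   = m + body bs

body+excess : ∀ bs → body bs + excess bs ≡ total bs
body+excess []                      = refl
body+excess (nil ∷ bs)              = body+excess bs
body+excess (coloured black m ∷ bs) =
  trans (+-assoc (suc m) (body bs) _) (cong (suc m +_) (body+excess bs))
body+excess (coloured red m ∷ bs)   =
  trans (+-suc _ _) (cong suc (trans (+-assoc m (body bs) _) (cong (m +_) (body+excess bs))))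

-- No part has been begun, or the current one is used up: only in these states may the reading stop
-- or the next part start.
data Ended : Maybe ℕ → Set where
  fresh : Ended nothing
  used  : Ended (just 0)

-- Reading a weak komposition from left to right against γ: the state is
-- `nothing` before the first nonzero entry, and then `just g`, where g is what
-- remains of the current part of γ.
data Parse : Maybe ℕ → List ℕ → List KEntry → Set where
  end   : ∀ {s} → Ended s → Parse s [] []
  nil   : ∀ {s γ bs} → Parse s γ bs → Parse s γ (nil ∷ bs)
  black : ∀ {g γ m bs} → Parse (just g) γ bs →
          Parse (just (suc m + g)) γ (coloured black m ∷ bs)
  red   : ∀ {g γ m bs} → Parse (just g) γ bs →
          Parse (just (m + g)) γ (coloured red m ∷ bs)
  start : ∀ {s g γ m bs} → Ended s → Parse (just g) γ bs →
          Parse s (suc m + g ∷ γ) (coloured black m ∷ bs)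

-- The cut points are implicit in the concatenation, and the bounds i_j ≤ n_j are left out: when the
-- nonzero entries of a fill its last positions, they follow from the later blocks being nonempty.
data Blocks : List ℕ → List KEntry → Set where
  done  : ∀ {bs} → All (λ x → value x ≡ 0) bs → Blocks [] bs
  cut : ∀ {g γ rest} blk → LeadingBlack blk → g + excess blk ≡ total blk →
          Blocks γ rest → Blocks (g ∷ γ) (blk ++ rest)

-- Inside a block the state is the `body` of what is left of the block; it is 0 at the end, where
-- `used` lets the next part start.
blocks⇒parse : ∀ {s γ bs} → Ended s → Blocks γ bs → Parse s γ bs
blocks⇒parse e (done z) = zeros z
  where
  zeros : ∀ {bs} → All (λ x → value x ≡ 0) bs → Parse _ [] bs
  zeros []                        = end e
  zeros {nil ∷ _} (_ ∷ z)         = nil (zeros z)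
  zeros {coloured _ _ ∷ _} (() ∷ _)
blocks⇒parse {s} {g ∷ γ} e (cut {rest = rest} blk lead eq b) =
  leading lead (+-cancelʳ-≡ (excess blk) _ _ (trans eq (sym (body+excess blk))))
  where
  within : ∀ bs → Parse (just (body bs)) γ (bs ++ rest)
  within []                      = blocks⇒parse used b
  within (nil ∷ bs)              = nil (within bs)
  within (coloured black m ∷ bs) = black (within bs)
  within (coloured red m ∷ bs)   = red (within bs)
  leading : ∀ {blk} → LeadingBlack blk → g ≡ body blk → Parse s (g ∷ γ) (blk ++ rest)
  leading (here {bs = bs}) refl = start e (within bs)
  leading (skip l) eq           = nil (leading l eq)

-- A cut may fall anywhere among the zeros between two blocks; here these zeros always go to the
-- earlier block.
parse-inside : ∀ {g γ bs} → Parse (just g) γ bs →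
  ∃ λ blk → ∃ λ rest → bs ≡ blk ++ rest × g ≡ body blk × Blocks γ rest
parse-inside (end used) = [] , [] , refl , refl , done []
parse-inside (nil p) with blk , rest , refl , refl , b ← parse-inside p =
  nil ∷ blk , rest , refl , refl , b
parse-inside (black {m = m} p) with blk , rest , refl , refl , b ← parse-inside p =
  coloured black m ∷ blk , rest , refl , refl , b
parse-inside (red {m = m} p) with blk , rest , refl , refl , b ← parse-inside p =
  coloured red m ∷ blk , rest , refl , refl , b
parse-inside (start {m = m} used p) with blk , rest , refl , refl , b ← parse-inside p =
  [] , coloured black m ∷ blk ++ rest , refl , refl ,
  cut (coloured black m ∷ blk) here (body+excess (coloured black m ∷ blk)) b

parse⇒blocks : ∀ {γ bs} → Parse nothing γ bs → Blocks γ bs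
parse⇒blocks (end fresh) = done []
parse⇒blocks (nil p) with parse⇒blocks p
... | done z              = done (refl ∷ z)
... | cut blk lead eq b = cut (nil ∷ blk) (skip lead) eq b
parse⇒blocks (start {m = m} fresh p) with blk , rest , refl , refl , b ← parse-inside p =
  cut (coloured black m ∷ blk) here (body+excess (coloured black m ∷ blk)) b

leadingBlack-nonempty : ∀ {blk} → LeadingBlack blk → 1 ≤ length blk
leadingBlack-nonempty here     = s≤s z≤n
leadingBlack-nonempty (skip _) = s≤s z≤n

blocks-length : ∀ {γ bs} → Blocks γ bs → length γ ≤ length bs
blocks-length (done _) = z≤n
blocks-length (cut {γ = γ} {rest} blk lead _ b) = begin
  suc (length γ)            ≤⟨ +-mono-≤ (leadingBlack-nonempty lead) (blocks-length b) ⟩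
  length blk + length rest  ≡⟨ List.length-++ blk ⟨
  length (blk ++ rest)      ∎
  where open ≤-Reasoning

drop-take-++-drop : {A : Set} {lo hi : ℕ} → lo ≤ hi → (xs : List A) →
  drop lo (take hi xs) ++ drop hi xs ≡ drop lo xs
drop-take-++-drop {hi = hi} z≤n xs = List.take++drop≡id hi xs
drop-take-++-drop (s≤s le) []       = refl
drop-take-++-drop (s≤s le) (x ∷ xs) = drop-take-++-drop le xs

drop-take-+ : {A : Set} (lo : ℕ) {blk rest xs : List A} → drop lo xs ≡ blk ++ rest →
  drop lo (take (lo + length blk) xs) ≡ blk × drop (lo + length blk) xs ≡ rest
drop-take-+ zero {blk} {rest} refl = take-length blk , drop-length blk
  where
  take-length : ∀ blk → take (length blk) (blk ++ rest) ≡ blk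
  take-length []      = refl
  take-length (x ∷ b) = cong (x ∷_) (take-length b)
  drop-length : ∀ blk → drop (length blk) (blk ++ rest) ≡ rest
  drop-length []      = refl
  drop-length (x ∷ b) = drop-length b
drop-take-+ (suc lo) {[]} {[]} {[]} eq = refl , refl
drop-take-+ (suc lo) {xs = x ∷ xs} eq  = drop-take-+ lo eq

module _ {n : ℕ} (a : Vec ℕ n) where
  open Glide a

  -- The support of a composition padded by leading zeros, with each position counted from the right
  -- end. This is the form from which the bound i_j ≤ n_j is recovered.
  LastPositions : List (Fin n) → Set
  LastPositions []       = ⊤
  LastPositions (p ∷ ps) = suc (toℕ p) + length ps ≡ n × LastPositions ps

  glideFrom⇒blocks : ∀ b {lo ps} → GlideFrom b lo ps →
    Blocks (map (lookup a) ps) (drop lo (Vec.toList b))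
  glideFrom⇒blocks b {lo} (done z) = done (zeros lo b z)
    where
    zeros : ∀ {k} lo (b : Vec KEntry k) → (∀ i → lo ≤ toℕ i → value (lookup b i) ≡ 0) →
      All (λ x → value x ≡ 0) (drop lo (Vec.toList b))
    zeros lo       []      z = All.drop⁺ lo []
    zeros zero     (x ∷ b) z = z zero z≤n ∷ zeros zero b (λ i _ → z (suc i) z≤n)
    zeros (suc lo) (x ∷ b) z = zeros lo b (λ i le → z (suc i) (s≤s le))
  glideFrom⇒blocks b {lo} (glide hi lo<hi hi≤ eq lead rest) =
    subst (Blocks _) (drop-take-++-drop (<⇒≤ lo<hi) (Vec.toList b))
      (cut (block b lo hi) lead eq (glideFrom⇒blocks b rest))

  blocks⇒glideFrom : ∀ b {lo ps γ bs} → LastPositions ps → Blocks γ bs →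
    drop lo (Vec.toList b) ≡ bs → γ ≡ map (lookup a) ps → GlideFrom b lo ps
  blocks⇒glideFrom b {lo} {[]} last (done z) refl refl = done (zeros lo b z)
    where
    zeros : ∀ {k} lo (b : Vec KEntry k) → All (λ x → value x ≡ 0) (drop lo (Vec.toList b)) →
      (∀ i → lo ≤ toℕ i → value (lookup b i) ≡ 0)
    zeros zero     (x ∷ b) (z ∷ _) zero    _        = z
    zeros zero     (x ∷ b) (_ ∷ z) (suc i) _        = zeros zero b z i z≤n
    zeros (suc lo) (x ∷ b) z       (suc i) (s≤s le) = zeros lo b z i le
  blocks⇒glideFrom b {lo} {p ∷ ps} (last , lasts) (cut {rest = rest} blk lead eq bs) split refl =
    glide (lo + length blk) (m<m+n lo (leadingBlack-nonempty lead)) hi≤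
      (subst (λ x → lookup a p + excess x ≡ total x) (sym blk≡) eq)
      (subst LeadingBlack (sym blk≡) lead)
      (blocks⇒glideFrom b lasts bs rest≡ refl)
    where
    blk≡ = proj₁ (drop-take-+ lo split)
    rest≡ = proj₂ (drop-take-+ lo split)
    len : length blk + length rest ≡ n ∸ lo
    len = begin
      length blk + length rest          ≡⟨ List.length-++ blk ⟨
      length (blk ++ rest)              ≡⟨ cong length split ⟨
      length (drop lo (Vec.toList b))   ≡⟨ List.length-drop lo (Vec.toList b) ⟩
      length (Vec.toList b) ∸ lo        ≡⟨ cong (_∸ lo) (Vec.length-toList b) ⟩
      n ∸ lo                            ∎
      where open ≡-Reasoning
    lo≤n : lo ≤ n
    lo≤n = <⇒≤ (m∸n≢0⇒n<m λ eq → <⇒≢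
      (≤-trans (leadingBlack-nonempty lead) (m≤m+n _ _)) (sym (trans len eq)))
    -- Each of the `length ps` later parts takes a nonempty block out of `rest`, so the cut is at
    -- least that far from the right end.
    hi≤ : lo + length blk ≤ suc (toℕ p)
    hi≤ = +-cancelʳ-≤ (length ps) _ _ (begin
      lo + length blk + length ps     ≤⟨ +-monoʳ-≤ (lo + length blk) (subst (_≤ length rest)
                                           (List.length-map (lookup a) ps) (blocks-length bs)) ⟩
      lo + length blk + length rest   ≡⟨ +-assoc lo _ _ ⟩
      lo + (length blk + length rest) ≡⟨ cong (lo +_) len ⟩
      lo + (n ∸ lo)                   ≡⟨ m+[n∸m]≡n lo≤n ⟩
      n                               ≡⟨ last ⟨
      suc (toℕ p) + length ps         ∎)
      where open ≤-Reasoning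

-- A red entry of value v uses up only v - 1, hence the extra 1 once a part has been begun. The
-- black entry beginning the part pays for it, so at the outset `sum γ` suffices.
bound : Maybe ℕ → List ℕ → ℕ
bound nothing  γ = sum γ
bound (just g) γ = suc (g + sum γ)

InRange : ℕ → KEntry → Set
InRange N nil            = ⊤
InRange N (coloured _ m) = m < N

InRange-mono : ∀ {M N} → M ≤ N → ∀ {x} → InRange M x → InRange N x
InRange-mono le {nil}          _ = tt
InRange-mono le {coloured _ _} h = <-≤-trans h le

parse-inRange : ∀ {s γ bs} → Parse s γ bs → All (InRange (bound s γ)) bs
parse-inRange (end _) = []
parse-inRange (nil p) = tt ∷ parse-inRange p
parse-inRange {γ = γ} (black {g} {m = m} p) =
  s≤s (≤-trans (m≤n+m m 1) (≤-trans (m≤m+n (suc m) g) (m≤m+n (suc m + g) _)))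
  ∷ All.map (InRange-mono (s≤s (+-monoˡ-≤ (sum γ) (m≤n+m g (suc m))))) (parse-inRange p)
parse-inRange {γ = γ} (red {g} {m = m} p) =
  s≤s (≤-trans (m≤m+n m g) (m≤m+n (m + g) _))
  ∷ All.map (InRange-mono (s≤s (+-monoˡ-≤ (sum γ) (m≤n+m g m)))) (parse-inRange p)
parse-inRange {γ = _ ∷ γ} (start {g = g} {m = m} e p) =
  ≤-trans (s≤s (≤-trans (m≤m+n m g) (m≤m+n (m + g) _))) (ended e)
  ∷ All.map (InRange-mono (≤-trans (s≤s (+-monoˡ-≤ (sum γ) (m≤n+m g m))) (ended e))) (parse-inRange p)
  where
  ended : ∀ {s γ} → Ended s → sum γ ≤ bound s γ
  ended fresh = ≤-refl
  ended used  = n≤1+n _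

-- What the glides see of the padded composition; `sum≡` enters because `Glide.glides` draws its
-- entries from a range given by `Vec.sum a`.
record Represents {n : ℕ} (a : Vec ℕ n) (γ : List ℕ) : Set where
  field
    values    : map (lookup a) (Glide.support a) ≡ γ
    positions : LastPositions a (Glide.support a)
    sum≡      : Vec.sum a ≡ sum γ

filter-map : {A B : Set} {P : B → Set} (P? : Decidable P) (f : A → B) →
  ∀ xs → filter P? (map f xs) ≡ map f (filter (P? ∘ f) xs)
filter-map P? f []       = refl
filter-map P? f (x ∷ xs) with does (P? (f x))
... | true  = cong (f x ∷_) (filter-map P? f xs)
... | false = filter-map P? f xs

support-tail : ∀ {n} x (a : Vec ℕ n) →
  filter (λ p → 0 <? lookup (x ∷ a) p) (List.tabulate suc) ≡ map suc (Glide.support a)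
support-tail {n} x a = trans
  (cong (filter _) (sym (List.map-tabulate id suc)))
  (filter-map (λ p → 0 <? lookup (x ∷ a) p) suc (allFin n))

lastPositions-suc : ∀ {n} x (a : Vec ℕ n) ps → LastPositions a ps → LastPositions (x ∷ a) (map suc ps)
lastPositions-suc x a []       _         = tt
lastPositions-suc x a (p ∷ ps) (eq , ls) =
  cong suc (trans (cong (suc (toℕ p) +_) (List.length-map suc ps)) eq) , lastPositions-suc x a ps ls

represents-zeros : ∀ k {n γ} {a : Vec ℕ n} → Represents a γ → Represents (Vec.replicate k 0 Vec.++ a) γ
represents-zeros zero    r = r
represents-zeros (suc k) {a = a} r = record
  { values    = trans (cong (map _) (support-tail 0 a′)) (trans (sym (List.map-∘ (Glide.support a′))) values)
  ; positions = subst (LastPositions (0 ∷ a′)) (sym (support-tail 0 a′))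
                  (lastPositions-suc 0 a′ (Glide.support a′) positions)
  ; sum≡      = sum≡
  }
  where
  a′ = Vec.replicate k 0 Vec.++ a
  open Represents (represents-zeros k r)

represents-fromList : ∀ {γ} → IsComposition γ → Represents (Vec.fromList γ) γ
represents-fromList [] = record { values = refl ; positions = tt ; sum≡ = refl }
represents-fromList {suc x ∷ γ} (_ ∷ pos) = record
  { values    = cong (suc x ∷_) (trans (cong (map _) (support-tail (suc x) a))
                  (trans (sym (List.map-∘ (Glide.support a))) values))
  ; positions = subst (LastPositions (suc x ∷ a)) (cong (zero ∷_) (sym (support-tail (suc x) a)))
                  (cong suc (trans (List.length-map suc (Glide.support a))
                    (trans (sym (List.length-map (lookup a) (Glide.support a))) (cong length values)))
                  , lastPositions-suc (suc x) a (Glide.support a) positions)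
  ; sum≡      = cong (suc x +_) sum≡
  }
  where
  a = Vec.fromList γ
  open Represents (represents-fromList pos)

represents-cast : ∀ {m n γ} {a : Vec ℕ m} (eq : m ≡ n) → Represents a γ → Represents (Vec.cast eq a) γ
represents-cast {γ = γ} {a} refl r = subst (λ a → Represents a γ) (sym (Vec.cast-is-id refl a)) r

padded : (n : ℕ) (γ : List ℕ) → length γ ≤ n → Vec ℕ n
padded n γ ℓ≤n = Vec.cast (m∸n+n≡m ℓ≤n) (Vec.replicate (n ∸ length γ) 0 Vec.++ Vec.fromList γ)

-- Follows the case split of `multifundamental`, so that membership is described by `Parse` whether
-- or not γ fits into n positions.
glidesOf : (n : ℕ) → List ℕ → List (WeakKomposition n)
glidesOf n γ with length γ ≤? n
... | yes ℓ≤n = Glide.glides (padded n γ ℓ≤n)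
... | no  _   = []

glideTerm : ∀ {n} → WeakKomposition n → Term n
glideTerm b = term 1ℤ (excess (Vec.toList b)) (Vec.map value b)

multifundamental-≡ : ∀ n γ → multifundamental n γ ≡ map glideTerm (glidesOf n γ)
multifundamental-≡ n γ with length γ ≤? n
... | yes ℓ≤n = refl
... | no  _   = refl

entries : ℕ → List KEntry
entries N = nil ∷ concatMap (λ m → coloured black m ∷ coloured red m ∷ []) (upTo N)

entries-complete : ∀ {N x} → InRange N x → x ∈ entries N
entries-complete {x = nil} _ = here refl
entries-complete {N} {coloured c m} m<N =
  there (∈-concatMap⁺ (λ m → coloured black m ∷ coloured red m ∷ []) {xs = upTo N} (lose (∈-upTo⁺ m<N) (colour c)))
  where
  colour : ∀ c → coloured c m ∈ coloured black m ∷ coloured red m ∷ []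
  colour black = here refl
  colour red   = there (here refl)

entries-unique : ∀ N → Unique (entries N)
entries-unique N =
  All.tabulate (λ {x} x∈ nil≡x → nil∉ (subst (_∈ _) (sym nil≡x) x∈))
  ∷ Unique-concatMap _ same (λ _ → ((λ ()) ∷ []) ∷ [] ∷ []) (Unique.upTo⁺ N)
  where
  nil∉ : nil ∉ concatMap (λ m → coloured black m ∷ coloured red m ∷ []) (upTo N)
  nil∉ p with find (∈-concatMap⁻ (λ m → coloured black m ∷ coloured red m ∷ []) {xs = upTo N} p)
  ... | _ , _ , here ()
  ... | _ , _ , there (here ())
  ... | _ , _ , there (there ())
  same : ∀ {m m′ z} → z ∈ coloured black m ∷ coloured red m ∷ [] →
    z ∈ coloured black m′ ∷ coloured red m′ ∷ [] → m ≡ m′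
  same (here refl)         (here refl)         = refl
  same (here refl)         (there (here ()))
  same (there (here refl)) (here ())
  same (there (here refl)) (there (here refl)) = refl

glidesOf-unique : ∀ n γ → Unique (glidesOf n γ)
glidesOf-unique n γ with length γ ≤? n
... | yes ℓ≤n = Unique.filter⁺ (Glide.isGlide? (padded n γ ℓ≤n))
  (vectors-unique (entries-unique (Vec.sum (padded n γ ℓ≤n))) n)
... | no  _   = []

padded-represents : ∀ n γ (ℓ≤n : length γ ≤ n) → IsComposition γ → Represents (padded n γ ℓ≤n) γ
padded-represents n γ ℓ≤n pos = represents-cast (m∸n+n≡m ℓ≤n)
  (represents-zeros (n ∸ length γ) (represents-fromList pos))

∈-glidesOf⁻ : ∀ {n γ b} → IsComposition γ → b ∈ glidesOf n γ → Parse nothing γ (Vec.toList b)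
∈-glidesOf⁻ {n} {γ} {b} pos b∈ with length γ ≤? n
... | yes ℓ≤n = blocks⇒parse fresh (subst (λ γ → Blocks γ (Vec.toList b)) values
  (glideFrom⇒blocks (padded n γ ℓ≤n) b
    (proj₂ (∈-filter⁻ (Glide.isGlide? (padded n γ ℓ≤n))
      {xs = vectors (entries (Vec.sum (padded n γ ℓ≤n))) n} b∈))))
  where open Represents (padded-represents n γ ℓ≤n pos)
... | no  _   with () ← b∈

∈-glidesOf⁺ : ∀ {n γ b} → IsComposition γ → Parse nothing γ (Vec.toList b) → b ∈ glidesOf n γ
∈-glidesOf⁺ {n} {γ} {b} pos p with length γ ≤? n
... | yes ℓ≤n = ∈-filter⁺ (Glide.isGlide? (padded n γ ℓ≤n))
  (vectors-complete _ b λ i → entries-complete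
    (subst (λ N → InRange N (lookup b i)) (sym sum≡) (inRange b i (parse-inRange p))))
  (blocks⇒glideFrom (padded n γ ℓ≤n) b positions (parse⇒blocks p) refl (sym values))
  where
  open Represents (padded-represents n γ ℓ≤n pos)
  inRange : ∀ {k N} (b : Vec KEntry k) i → All (InRange N) (Vec.toList b) → InRange N (lookup b i)
  inRange (x ∷ b) zero    (h ∷ _) = h
  inRange (x ∷ b) (suc i) (_ ∷ h) = inRange b i h
-- Every part needs a nonempty block, so nothing of length n parses a composition with more than n
-- parts.
... | no  ℓ≰n = contradiction
  (subst (length γ ≤_) (Vec.length-toList b) (blocks-length (parse⇒blocks p))) ℓ≰n

-- Coefficients

infix 8 β^_
β^_ : ℕ → ℕ[β]
β^ zero    = 1 ∷ []
β^ (suc j) = 0 ∷ β^ j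

infixl 6 _⊞_
_⊞_ : ℕ[β] → ℕ[β] → ℕ[β]
[]      ⊞ K       = K
(c ∷ J) ⊞ []      = c ∷ J
(c ∷ J) ⊞ (d ∷ K) = c + d ∷ J ⊞ K

module _ {n : ℕ} where

  βshift : ℕ → Poly n → Poly n
  βshift j = map λ (term d k e) → term d (j + k) e

  contribution : Term n → ℕ → Vec ℕ n → ℤ.ℤ
  contribution (term c k′ e′) k e = if does (k′ ≟ k ×-dec Vec.≡-dec _≟_ e′ e) then c else 0ℤ

  coeff-++ : ∀ p q k e → coeff {n} (p ++ q) k e ≡ coeff p k e ℤ.+ coeff q k e
  coeff-++ []                 q k e = sym (ℤ.+-identityˡ _)
  coeff-++ (t ∷ p) q k e =
    trans (cong (ℤ._+_ (contribution t k e)) (coeff-++ p q k e)) (sym (ℤ.+-assoc (contribution t k e) _ _))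

  -- Carries bijections between index lists over to polynomials.
  coeff-↭ : ∀ {p q} → p ↭ q → ∀ k e → coeff {n} p k e ≡ coeff q k e
  coeff-↭ ↭.refl       k e = refl
  coeff-↭ (prep t σ)   k e = cong (ℤ._+_ (contribution t k e)) (coeff-↭ σ k e)
  coeff-↭ (swap t u σ) k e =
    trans (cong (λ z → contribution t k e ℤ.+ (contribution u k e ℤ.+ z)) (coeff-↭ σ k e))
      (exchange (contribution t k e) (contribution u k e) _)
    where
    exchange : ∀ x y z → x ℤ.+ (y ℤ.+ z) ≡ y ℤ.+ (x ℤ.+ z)
    exchange = solve-∀
  coeff-↭ (↭.trans σ τ)  k e = trans (coeff-↭ σ k e) (coeff-↭ τ k e)

  coeff-βsuc-zero : ∀ p e → coeff (βshift 1 p) 0 e ≡ 0ℤ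
  coeff-βsuc-zero []      e = refl
  coeff-βsuc-zero (_ ∷ p) e = trans (ℤ.+-identityˡ _) (coeff-βsuc-zero p e)

  coeff-βsuc : ∀ p k e → coeff (βshift 1 p) (suc k) e ≡ coeff p k e
  coeff-βsuc []      k e = refl
  coeff-βsuc (t ∷ p) k e = cong (ℤ._+_ (contribution t k e)) (coeff-βsuc p k e)

  βsuc-cong : ∀ {p q} → p ≈ q → βshift 1 p ≈ βshift 1 q
  βsuc-cong {p} {q} p≈q zero    e = trans (coeff-βsuc-zero p e) (sym (coeff-βsuc-zero q e))
  βsuc-cong {p} {q} p≈q (suc k) e =
    trans (coeff-βsuc p k e) (trans (p≈q k e) (sym (coeff-βsuc q k e)))

  scale : ℕ → Poly n → Poly n
  scale c = map λ (term d k e) → term (ℤ.+ c ℤ.* d) k e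

  if-* : ∀ b (c d : ℤ.ℤ) → (if b then c ℤ.* d else 0ℤ) ≡ c ℤ.* (if b then d else 0ℤ)
  if-* true  c d = refl
  if-* false c d = sym (ℤ.*-zeroʳ c)

  coeff-scale : ∀ c p k e → coeff (scale c p) k e ≡ ℤ.+ c ℤ.* coeff p k e
  coeff-scale c []                 k e = sym (ℤ.*-zeroʳ (ℤ.+ c))
  coeff-scale c (term d k′ e′ ∷ p) k e = trans
    (cong₂ ℤ._+_ (if-* (does (k′ ≟ k ×-dec Vec.≡-dec _≟_ e′ e)) (ℤ.+ c) d) (coeff-scale c p k e))
    (sym (ℤ.*-distribˡ-+ (ℤ.+ c) _ (coeff p k e)))

  coeff-∷· : ∀ c J (p : Poly n) k e →
    coeff ((c ∷ J) · p) k e ≡ ℤ.+ c ℤ.* coeff p k e ℤ.+ coeff (βshift 1 (J · p)) k e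
  coeff-∷· c J p k e = trans (coeff-++ (scale c p) _ k e) (cong (λ z → z ℤ.+ _) (coeff-scale c p k e))

  -- The product also lists terms with coefficient 0 for the lower powers of β, so the two sides
  -- agree in their coefficients but not as lists.
  β^·≈βshift : ∀ j (p : Poly n) → (β^ j) · p ≈ βshift j p
  β^·≈βshift zero p k e = begin
    coeff ((1 ∷ []) · p) k e            ≡⟨ coeff-∷· 1 [] p k e ⟩
    1ℤ ℤ.* coeff p k e ℤ.+ 0ℤ           ≡⟨ unit (coeff p k e) ⟩
    coeff p k e                         ≡⟨ cong (λ p → coeff p k e) (List.map-id p) ⟨
    coeff (βshift 0 p) k e              ∎
    where
    open ≡-Reasoning
    unit : ∀ x → 1ℤ ℤ.* x ℤ.+ 0ℤ ≡ x
    unit = solve-∀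
  β^·≈βshift (suc j) p k e = begin
    coeff ((0 ∷ β^ j) · p) k e                                   ≡⟨ coeff-∷· 0 (β^ j) p k e ⟩
    0ℤ ℤ.* coeff p k e ℤ.+ coeff (βshift 1 ((β^ j) · p)) k e     ≡⟨ ℤ.+-identityˡ _ ⟩
    coeff (βshift 1 ((β^ j) · p)) k e                            ≡⟨ βsuc-cong {(β^ j) · p} {βshift j p}
                                                                      (β^·≈βshift j p) k e ⟩
    coeff (βshift 1 (βshift j p)) k e                            ≡⟨ cong (λ p → coeff p k e) (sym (List.map-∘ p)) ⟩
    coeff (βshift (suc j) p) k e                                 ∎
    where open ≡-Reasoning

  coeff-⊞ : ∀ J K (p : Poly n) k e → coeff ((J ⊞ K) · p) k e ≡ coeff (J · p) k e ℤ.+ coeff (K · p) k e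
  coeff-⊞ []      K       p k e = sym (ℤ.+-identityˡ _)
  coeff-⊞ (c ∷ J) []      p k e = sym (ℤ.+-identityʳ _)
  coeff-⊞ (c ∷ J) (d ∷ K) p k e = begin
    coeff ((c + d ∷ J ⊞ K) · p) k e
      ≡⟨ coeff-∷· (c + d) (J ⊞ K) p k e ⟩
    ℤ.+ (c + d) ℤ.* x ℤ.+ coeff (βshift 1 ((J ⊞ K) · p)) k e
      ≡⟨ cong₂ (λ u v → u ℤ.* x ℤ.+ v) (ℤ.pos-+ c d) (ih k) ⟩
    (ℤ.+ c ℤ.+ ℤ.+ d) ℤ.* x ℤ.+ (coeff (βshift 1 (J · p)) k e ℤ.+ coeff (βshift 1 (K · p)) k e)
      ≡⟨ rearrange (ℤ.+ c) (ℤ.+ d) x _ _ ⟩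
    ℤ.+ c ℤ.* x ℤ.+ coeff (βshift 1 (J · p)) k e ℤ.+ (ℤ.+ d ℤ.* x ℤ.+ coeff (βshift 1 (K · p)) k e)
      ≡⟨ cong₂ ℤ._+_ (coeff-∷· c J p k e) (coeff-∷· d K p k e) ⟨
    coeff ((c ∷ J) · p) k e ℤ.+ coeff ((d ∷ K) · p) k e ∎
    where
    open ≡-Reasoning
    x = coeff p k e
    rearrange : ∀ c d x y z → (c ℤ.+ d) ℤ.* x ℤ.+ (y ℤ.+ z) ≡ c ℤ.* x ℤ.+ y ℤ.+ (d ℤ.* x ℤ.+ z)
    rearrange = solve-∀
    ih : ∀ k → coeff (βshift 1 ((J ⊞ K) · p)) k e ≡
      coeff (βshift 1 (J · p)) k e ℤ.+ coeff (βshift 1 (K · p)) k e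
    ih zero = trans (coeff-βsuc-zero ((J ⊞ K) · p) e)
      (sym (cong₂ ℤ._+_ (coeff-βsuc-zero (J · p) e) (coeff-βsuc-zero (K · p) e)))
    ih (suc k) = trans (coeff-βsuc ((J ⊞ K) · p) k e) (trans (coeff-⊞ J K p k e)
      (sym (cong₂ ℤ._+_ (coeff-βsuc (J · p) k e) (coeff-βsuc (K · p) k e))))

_≟ᶜ_ : (γ δ : List ℕ) → Dec (γ ≡ δ)
_≟ᶜ_ = List.≡-dec _≟_

-- With a pair (j , δ) standing for β^j F̄_δ, this is the coefficient of F̄_γ in the sum of all
-- pairs. Only powers of β are ever added, which is the source of positivity.
multiplicity : List (ℕ × List ℕ) → List ℕ → ℕ[β]
multiplicity []             γ = []
multiplicity ((j , δ) ∷ ts) γ =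
  if does (δ ≟ᶜ γ) then β^ j ⊞ multiplicity ts γ else multiplicity ts γ

multiplicity-∉ : ∀ ts {γ} → γ ∉ map proj₂ ts → multiplicity ts γ ≡ []
multiplicity-∉ []             γ∉ = refl
multiplicity-∉ ((j , δ) ∷ ts) {γ} γ∉ with δ ≟ᶜ γ
... | yes refl = contradiction (here refl) γ∉
... | no  _      = multiplicity-∉ ts (γ∉ ∘ there)


multiplicity-∈ : ∀ j δ ts → multiplicity ((j , δ) ∷ ts) δ ≡ β^ j ⊞ multiplicity ts δ
multiplicity-∈ j δ ts rewrite dec-true (δ ≟ᶜ δ) refl = refl

multiplicity-≢ : ∀ j {δ γ} ts → δ ≢ γ → multiplicity ((j , δ) ∷ ts) γ ≡ multiplicity ts γ
multiplicity-≢ j {δ} {γ} ts δ≢γ rewrite dec-false (δ ≟ᶜ γ) δ≢γ = refl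

module _ {n : ℕ} (P : List ℕ → Poly n) where

  weighted : List (ℕ × List ℕ) → List (List ℕ) → Poly n
  weighted ts supp = sumOver supp λ γ → multiplicity ts γ · P γ

  weighted-∉ : ∀ j δ ts supp → All (δ ≢_) supp → weighted ((j , δ) ∷ ts) supp ≡ weighted ts supp
  weighted-∉ j δ ts []         []       = refl
  weighted-∉ j δ ts (γ ∷ supp) (≢ ∷ ≢s) =
    cong₂ (λ J q → J · P γ ++ q) (multiplicity-≢ j ts ≢) (weighted-∉ j δ ts supp ≢s)

  -- The new pair affects the coefficient of δ alone, and δ occurs exactly once in `supp`.
  weighted-∈ : ∀ j δ ts {supp} → Unique supp → δ ∈ supp → ∀ k e →
    coeff (weighted ((j , δ) ∷ ts) supp) k e ≡ coeff (βshift j (P δ)) k e ℤ.+ coeff (weighted ts supp) k e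
  weighted-∈ j δ ts {_ ∷ supp} (δ∉ ∷ u) (here refl) k e = begin
    coeff (multiplicity ((j , δ) ∷ ts) δ · P δ ++ weighted ((j , δ) ∷ ts) supp) k e
      ≡⟨ cong₂ (λ J q → coeff (J · P δ ++ q) k e) (multiplicity-∈ j δ ts) (weighted-∉ j δ ts supp δ∉) ⟩
    coeff ((β^ j ⊞ multiplicity ts δ) · P δ ++ weighted ts supp) k e
      ≡⟨ coeff-++ ((β^ j ⊞ multiplicity ts δ) · P δ) _ k e ⟩
    coeff ((β^ j ⊞ multiplicity ts δ) · P δ) k e ℤ.+ coeff (weighted ts supp) k e
      ≡⟨ cong (λ z → z ℤ.+ coeff (weighted ts supp) k e) (trans (coeff-⊞ (β^ j) (multiplicity ts δ) (P δ) k e)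
           (cong (λ z → z ℤ.+ coeff (multiplicity ts δ · P δ) k e) (β^·≈βshift j (P δ) k e))) ⟩
    coeff (βshift j (P δ)) k e ℤ.+ coeff (multiplicity ts δ · P δ) k e ℤ.+ coeff (weighted ts supp) k e
      ≡⟨ ℤ.+-assoc (coeff (βshift j (P δ)) k e) _ _ ⟩
    coeff (βshift j (P δ)) k e ℤ.+ (coeff (multiplicity ts δ · P δ) k e ℤ.+ coeff (weighted ts supp) k e)
      ≡⟨ cong (ℤ._+_ (coeff (βshift j (P δ)) k e)) (coeff-++ (multiplicity ts δ · P δ) _ k e) ⟨
    coeff (βshift j (P δ)) k e ℤ.+ coeff (multiplicity ts δ · P δ ++ weighted ts supp) k e ∎
    where open ≡-Reasoning
  weighted-∈ j δ ts {γ ∷ supp} (γ∉ ∷ u) (there δ∈) k e = begin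
    coeff (multiplicity ((j , δ) ∷ ts) γ · P γ ++ weighted ((j , δ) ∷ ts) supp) k e
      ≡⟨ cong (λ J → coeff (J · P γ ++ weighted ((j , δ) ∷ ts) supp) k e)
           (multiplicity-≢ j ts λ δ≡γ → All.lookup γ∉ δ∈ (sym δ≡γ)) ⟩
    coeff (multiplicity ts γ · P γ ++ weighted ((j , δ) ∷ ts) supp) k e
      ≡⟨ coeff-++ (multiplicity ts γ · P γ) _ k e ⟩
    coeff (multiplicity ts γ · P γ) k e ℤ.+ coeff (weighted ((j , δ) ∷ ts) supp) k e
      ≡⟨ cong (ℤ._+_ (coeff (multiplicity ts γ · P γ) k e)) (weighted-∈ j δ ts u δ∈ k e) ⟩
    coeff (multiplicity ts γ · P γ) k e ℤ.+ (coeff (βshift j (P δ)) k e ℤ.+ coeff (weighted ts supp) k e)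
      ≡⟨ exchange (coeff (multiplicity ts γ · P γ) k e) (coeff (βshift j (P δ)) k e) _ ⟩
    coeff (βshift j (P δ)) k e ℤ.+ (coeff (multiplicity ts γ · P γ) k e ℤ.+ coeff (weighted ts supp) k e)
      ≡⟨ cong (ℤ._+_ (coeff (βshift j (P δ)) k e)) (coeff-++ (multiplicity ts γ · P γ) _ k e) ⟨
    coeff (βshift j (P δ)) k e ℤ.+ coeff (multiplicity ts γ · P γ ++ weighted ts supp) k e ∎
    where
    open ≡-Reasoning
    exchange : ∀ x y z → x ℤ.+ (y ℤ.+ z) ≡ y ℤ.+ (x ℤ.+ z)
    exchange = solve-∀

  weighted-≈ : ∀ ts {supp} → Unique supp → (∀ {δ} → δ ∈ map proj₂ ts → δ ∈ supp) →
    weighted ts supp ≈ sumOver ts λ (j , δ) → βshift j (P δ)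
  weighted-≈ [] {supp} u ⊆ k e = cong (λ p → coeff p k e) (empty supp)
    where
    empty : ∀ supp → weighted [] supp ≡ []
    empty []         = refl
    empty (_ ∷ supp) = empty supp
  weighted-≈ ((j , δ) ∷ ts) u ⊆ k e =
    trans (weighted-∈ j δ ts u (⊆ (here refl)) k e)
      (trans (cong (ℤ._+_ (coeff (βshift j (P δ)) k e)) (weighted-≈ ts u (⊆ ∘ there) k e))
        (sym (coeff-++ (βshift j (P δ)) _ k e)))

-- Two exponents are allowed so that quasisymmetry passes from the summands to the sum.
sumOver-cong : ∀ {A : Set} {n} {f g : A → Poly n} xs k e e′ →
  (∀ {x} → x ∈ xs → coeff (f x) k e ≡ coeff (g x) k e′) →
  coeff (sumOver xs f) k e ≡ coeff (sumOver xs g) k e′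
sumOver-cong []       k e e′ eq = refl
sumOver-cong {f = f} {g} (x ∷ xs) k e e′ eq = trans (coeff-++ (f x) _ k e)
  (trans (cong₂ ℤ._+_ (eq (here refl)) (sumOver-cong xs k e e′ (eq ∘ there)))
    (sym (coeff-++ (g x) _ k e′)))

coeff-monomials : ∀ {A : Set} {n} (d : A → ℕ) (m : A → Vec ℕ n) xs k e →
  coeff (map (λ x → term 1ℤ (d x) (m x)) xs) k e ≡
  ℤ.+ length (filter (λ x → d x ≟ k ×-dec Vec.≡-dec _≟_ (m x) e) xs)
coeff-monomials d m []       k e = refl
coeff-monomials d m (x ∷ xs) k e with does (d x ≟ k ×-dec Vec.≡-dec _≟_ (m x) e)
... | true  = cong (ℤ._+_ 1ℤ) (coeff-monomials d m xs k e)
... | false = trans (ℤ.+-identityˡ _) (coeff-monomials d m xs k e)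

-- Quasisymmetry

nonzeros : List KEntry → List KEntry
nonzeros []                  = []
nonzeros (nil ∷ bs)          = nonzeros bs
nonzeros (coloured c m ∷ bs) = coloured c m ∷ nonzeros bs

excess-nonzeros : ∀ bs → excess (nonzeros bs) ≡ excess bs
excess-nonzeros []                  = refl
excess-nonzeros (nil ∷ bs)          = excess-nonzeros bs
excess-nonzeros (coloured c m ∷ bs) = cong (redness (coloured c m) +_) (excess-nonzeros bs)

parse-nonzeros⁺ : ∀ {s γ bs} → Parse s γ bs → Parse s γ (nonzeros bs)
parse-nonzeros⁺ (end e)     = end e
parse-nonzeros⁺ (nil p)     = parse-nonzeros⁺ p
parse-nonzeros⁺ (black p)   = black (parse-nonzeros⁺ p)
parse-nonzeros⁺ (red p)     = red (parse-nonzeros⁺ p)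
parse-nonzeros⁺ (start e p) = start e (parse-nonzeros⁺ p)

parse-nonzeros⁻ : ∀ {s γ} bs → Parse s γ (nonzeros bs) → Parse s γ bs
parse-nonzeros⁻ []                      p           = p
parse-nonzeros⁻ (nil ∷ bs)              p           = nil (parse-nonzeros⁻ bs p)
parse-nonzeros⁻ (coloured black m ∷ bs) (black p)   = black (parse-nonzeros⁻ bs p)
parse-nonzeros⁻ (coloured black m ∷ bs) (start e p) = start e (parse-nonzeros⁻ bs p)
parse-nonzeros⁻ (coloured red m ∷ bs)   (red p)     = red (parse-nonzeros⁻ bs p)

-- The values tell where the zeros stand, the nonzero entries supply the colours.
nonzeros-injective : ∀ {n} {b b′ : WeakKomposition n} → Vec.map value b ≡ Vec.map value b′ →
  nonzeros (Vec.toList b) ≡ nonzeros (Vec.toList b′) → b ≡ b′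
nonzeros-injective {b = []} {[]} _ _ = refl
nonzeros-injective {b = nil ∷ b} {nil ∷ b′} v nz =
  cong (nil ∷_) (nonzeros-injective (Vec.∷-injectiveʳ v) nz)
nonzeros-injective {b = nil ∷ b} {coloured _ _ ∷ b′} v nz with () ← Vec.∷-injectiveˡ v
nonzeros-injective {b = coloured _ _ ∷ b} {nil ∷ b′} v nz with () ← Vec.∷-injectiveˡ v
nonzeros-injective {b = coloured _ _ ∷ b} {coloured _ _ ∷ b′} v nz =
  cong₂ _∷_ (List.∷-injectiveˡ nz) (nonzeros-injective (Vec.∷-injectiveʳ v) (List.∷-injectiveʳ nz))

positivePart-value : ∀ {n} (b : WeakKomposition n) →
  map value (nonzeros (Vec.toList b)) ≡ positivePart (Vec.map value b)
positivePart-value []                 = refl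
positivePart-value (nil ∷ b)          = positivePart-value b
positivePart-value (coloured _ m ∷ b) = cong (suc m ∷_) (positivePart-value b)

-- Spreads u over the nonzero positions of a; this moves a glide from one exponent to any other with
-- the same positive part.
fill : ∀ {n} (a : Vec ℕ n) u → map value u ≡ positivePart a →
  ∃ λ (b : WeakKomposition n) → Vec.map value b ≡ a × nonzeros (Vec.toList b) ≡ u
fill []          []                  _  = [] , refl , refl
fill (zero ∷ a)  u                   eq = let b , v , nz = fill a u eq in
  nil ∷ b , cong (0 ∷_) v , nz
fill (suc x ∷ a) (nil ∷ u)           eq with () ← List.∷-injectiveˡ eq
fill (suc x ∷ a) (coloured c m ∷ u)  eq = let b , v , nz = fill a u (List.∷-injectiveʳ eq) in
  coloured c m ∷ b , cong₂ _∷_ (List.∷-injectiveˡ eq) v , cong (coloured c m ∷_) nz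

βshift-multifundamental : ∀ {n} j γ → βshift j (multifundamental n γ) ≡
  map (λ b → term 1ℤ (j + excess (Vec.toList b)) (Vec.map value b)) (glidesOf n γ)
βshift-multifundamental {n} j γ =
  trans (cong (βshift j) (multifundamental-≡ n γ)) (sym (List.map-∘ (glidesOf n γ)))

module _ {n : ℕ} {γ : List ℕ} (pos : IsComposition γ) (j k : ℕ) where

  match? : (a : Vec ℕ n) (b : WeakKomposition n) → Dec (j + excess (Vec.toList b) ≡ k × Vec.map value b ≡ a)
  match? a b = j + excess (Vec.toList b) ≟ k ×-dec Vec.≡-dec _≟_ (Vec.map value b) a

  matching : Vec ℕ n → List (List KEntry)
  matching a = map (nonzeros ∘ Vec.toList) (filter (match? a) (glidesOf n γ))

  matching-unique : ∀ a → Unique (matching a)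
  matching-unique a = Unique-map (nonzeros ∘ Vec.toList)
    (λ p q → nonzeros-injective (trans (values p) (sym (values q))))
    (Unique.filter⁺ (match? a) (glidesOf-unique n γ))
    where
    values : ∀ {b} → b ∈ filter (match? a) (glidesOf n γ) → Vec.map value b ≡ a
    values p = proj₂ (proj₂ (∈-filter⁻ (match? a) {xs = glidesOf n γ} p))

  matching-⊆ : ∀ {a a′} → positivePart a ≡ positivePart a′ → ∀ {u} → u ∈ matching a → u ∈ matching a′
  matching-⊆ {a} {a′} eq u∈
    with b , b∈ , refl ← ∈-map⁻ (nonzeros ∘ Vec.toList) u∈
    with b∈g , ex≡ , refl ← ∈-filter⁻ (match? a) {xs = glidesOf n γ} b∈
    with b′ , v , nz ← fill a′ (nonzeros (Vec.toList b)) (trans (positivePart-value b) eq) =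
    subst (_∈ matching a′) nz (∈-map⁺ (nonzeros ∘ Vec.toList) (∈-filter⁺ (match? a′) b′∈g (ex≡′ , v)))
    where
    b′∈g : b′ ∈ glidesOf n γ
    b′∈g = ∈-glidesOf⁺ pos (parse-nonzeros⁻ (Vec.toList b′)
      (subst (Parse nothing γ) (sym nz) (parse-nonzeros⁺ (∈-glidesOf⁻ pos b∈g))))
    ex≡′ : j + excess (Vec.toList b′) ≡ k
    ex≡′ = trans (cong (j +_) (trans (sym (excess-nonzeros (Vec.toList b′)))
      (trans (cong excess nz) (excess-nonzeros (Vec.toList b))))) ex≡

  -- A glide with exponent a is determined by its coloured nonzero entries. Since `Parse` passes
  -- over zeros, the lists of such entries that occur depend on a⁺ only.
  multifundamental-quasisymmetric : ∀ a a′ → positivePart a ≡ positivePart a′ →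
    coeff (βshift j (multifundamental n γ)) k a ≡ coeff (βshift j (multifundamental n γ)) k a′
  multifundamental-quasisymmetric a a′ eq =
    trans (count a) (trans (cong ℤ.+_ (Perm.↭-length
      (sameMembers⇒↭ (matching-unique a) (matching-unique a′) (matching-⊆ eq) (matching-⊆ (sym eq)))))
      (sym (count a′)))
    where
    count : ∀ a → coeff (βshift j (multifundamental n γ)) k a ≡ ℤ.+ length (matching a)
    count a = begin
      coeff (βshift j (multifundamental n γ)) k a
        ≡⟨ cong (λ p → coeff p k a) (βshift-multifundamental j γ) ⟩
      coeff (map (λ b → term 1ℤ (j + excess (Vec.toList b)) (Vec.map value b)) (glidesOf n γ)) k a
        ≡⟨ coeff-monomials _ _ (glidesOf n γ) k a ⟩
      ℤ.+ length (filter (match? a) (glidesOf n γ))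
        ≡⟨ cong ℤ.+_ (List.length-map _ (filter (match? a) (glidesOf n γ))) ⟨
      ℤ.+ length (matching a) ∎
      where open ≡-Reasoning

-- Words and codes

Cell : Set
Cell = ℕ × ℕ

column : Cell → ℕ
column = proj₂

infix 4 _⊳_
_⊳_ : Cell → Cell → Set
c ⊳ d = column d < column c

⊳-trans : ∀ {c d e} → c ⊳ d → d ⊳ e → c ⊳ e
⊳-trans p q = <-trans q p

_≟ᶜᵉ_ : DecidableEquality Cell
_≟ᶜᵉ_ = Product.≡-dec _≟_ _≟_

_≟ᵐ_ : DecidableEquality (Maybe Cell)
_≟ᵐ_ = Maybe.≡-dec _≟ᶜᵉ_

Descending : List Cell → Set
Descending = Linked _⊳_

descending⇒allPairs : ∀ {cs} → Descending cs → AllPairs _⊳_ cs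
descending⇒allPairs = Linked⇒AllPairs λ {c} {d} {e} → ⊳-trans {c} {d} {e}

-- The boxes containing 1, …, n, each list to be read from right to left.
Code : ℕ → Set
Code = Vec (List Cell)

final : Cell → List Cell → Cell
final c []       = c
final c (d ∷ ds) = final d ds

-- `Split p b w C`: w is the concatenation of the lists in C, except that the
-- first cell of a list is omitted when it repeats the last cell of the previous
-- nonempty list (p for the first one); b records the lengths of the lists, those
-- with an omission being red.
data Split : Maybe Cell → ∀ {n} → WeakKomposition n → List Cell → Code n → Set where
  done  : ∀ {p} → Split p [] [] []
  nil   : ∀ {p n} {b : WeakKomposition n} {w C} → Split p b w C → Split p (nil ∷ b) w ([] ∷ C)
  black : ∀ {p n} {b : WeakKomposition n} {w C c cs} → p ≢ just c →
          Split (just (final c cs)) b w C →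
          Split p (coloured black (length cs) ∷ b) (c ∷ cs ++ w) ((c ∷ cs) ∷ C)
  red   : ∀ {n} {b : WeakKomposition n} {w C c cs} →
          Split (just (final c cs)) b w C →
          Split (just c) (coloured red (length cs) ∷ b) (cs ++ w) ((c ∷ cs) ∷ C)

kompFrom : Maybe Cell → ∀ {n} → Code n → WeakKomposition n
kompFrom p []             = []
kompFrom p ([] ∷ C)       = nil ∷ kompFrom p C
kompFrom p ((c ∷ cs) ∷ C) with p ≟ᵐ just c
... | yes _ = coloured red (length cs) ∷ kompFrom (just (final c cs)) C
... | no  _ = coloured black (length cs) ∷ kompFrom (just (final c cs)) C

wordFrom : Maybe Cell → ∀ {n} → Code n → List Cell
wordFrom p []             = []
wordFrom p ([] ∷ C)       = wordFrom p C
wordFrom p ((c ∷ cs) ∷ C) with p ≟ᵐ just c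
... | yes _ = cs ++ wordFrom (just (final c cs)) C
... | no  _ = c ∷ cs ++ wordFrom (just (final c cs)) C

split : ∀ p {n} (C : Code n) → Split p (kompFrom p C) (wordFrom p C) C
split p []             = done
split p ([] ∷ C)       = nil (split p C)
split p ((c ∷ cs) ∷ C) with p ≟ᵐ just c
... | yes refl = red (split (just (final c cs)) C)
... | no  p≢c  = black p≢c (split (just (final c cs)) C)

split-functional : ∀ {p n} {b : WeakKomposition n} {w C} → Split p b w C →
  kompFrom p C ≡ b × wordFrom p C ≡ w
split-functional done = refl , refl
split-functional (nil s) = let eq , eq′ = split-functional s in cong (nil ∷_) eq , eq′
split-functional {p} (black {c = c} {cs} p≢c s) with p ≟ᵐ just c
... | yes eq = contradiction eq p≢c
... | no  _  = let eq , eq′ = split-functional s in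
  cong (coloured black (length cs) ∷_) eq , cong (λ w → c ∷ cs ++ w) eq′
split-functional (red {c = c} {cs} s) with just c ≟ᵐ just c
... | yes _  = let eq , eq′ = split-functional s in
  cong (coloured red (length cs) ∷_) eq , cong (cs ++_) eq′
... | no c≢c = contradiction refl c≢c

-- The lengths in b say where to cut w, and a red piece begins with the previous cell again. The
-- results for a black entry facing an empty word and for a red entry with no previous cell are
-- arbitrary defaults; no `Split` reaches these cases.
rebuild : Maybe Cell → ∀ {n} → WeakKomposition n → List Cell → Code n
rebuild p        []                     w       = []
rebuild p        (nil ∷ b)              w       = [] ∷ rebuild p b w
rebuild p        (coloured black m ∷ b) []      = [] ∷ rebuild p b []
rebuild p        (coloured black m ∷ b) (c ∷ w) =
  (c ∷ take m w) ∷ rebuild (just (final c (take m w))) b (drop m w)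
rebuild nothing  (coloured red m ∷ b)   w       = [] ∷ rebuild nothing b w
rebuild (just c) (coloured red m ∷ b)   w       =
  (c ∷ take m w) ∷ rebuild (just (final c (take m w))) b (drop m w)

take-length-++ : {A : Set} (xs ys : List A) → take (length xs) (xs ++ ys) ≡ xs
take-length-++ []       ys = refl
take-length-++ (x ∷ xs) ys = cong (x ∷_) (take-length-++ xs ys)

drop-length-++ : {A : Set} (xs ys : List A) → drop (length xs) (xs ++ ys) ≡ ys
drop-length-++ []       ys = refl
drop-length-++ (x ∷ xs) ys = drop-length-++ xs ys

rebuild-split : ∀ {p n} {b : WeakKomposition n} {w C} → Split p b w C → rebuild p b w ≡ C
rebuild-split done    = refl
rebuild-split (nil s) = cong ([] ∷_) (rebuild-split s)
rebuild-split (black {w = w} {cs = cs} _ s)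
  rewrite take-length-++ cs w | drop-length-++ cs w = cong (_ ∷_) (rebuild-split s)
rebuild-split (red {w = w} {cs = cs} s)
  rewrite take-length-++ cs w | drop-length-++ cs w = cong (_ ∷_) (rebuild-split s)

split-injective : ∀ {p n} {b : WeakKomposition n} {w C C′} → Split p b w C → Split p b w C′ → C ≡ C′
split-injective s s′ = trans (sym (rebuild-split s)) (rebuild-split s′)

-- Runs of a word and its splittings

-- What makes a word splittable at any place by a black piece: a black piece beginning with the
-- previous cell would be indistinguishable from a red one.
data NoRepeat : Maybe Cell → List Cell → Set where
  []  : ∀ {p} → NoRepeat p []
  _∷_ : ∀ {p c w} → p ≢ just c → NoRepeat (just c) w → NoRepeat p (c ∷ w)

⊳⇒≢ : ∀ {c d} → c ⊳ d → just c ≢ just d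
⊳⇒≢ lt refl = <-irrefl refl lt

noRepeat-++ : ∀ {c cs w} → Descending (c ∷ cs) → NoRepeat (just (final c cs)) w → NoRepeat (just c) (cs ++ w)
noRepeat-++ [-]      h = h
noRepeat-++ (gt ∷ l) h = ⊳⇒≢ gt ∷ noRepeat-++ l h

noRepeat-drop : ∀ {c} cs {w} → NoRepeat (just c) (cs ++ w) → NoRepeat (just (final c cs)) w
noRepeat-drop []       h       = h
noRepeat-drop (_ ∷ cs) (_ ∷ h) = noRepeat-drop cs h

split-noRepeat : ∀ {p n} {b : WeakKomposition n} {w C} → Split p b w C →
  (∀ v → Descending (lookup C v)) → NoRepeat p w
split-noRepeat done           desc = []
split-noRepeat (nil s)        desc = split-noRepeat s (desc ∘ suc)
split-noRepeat (black p≢c s)  desc = p≢c ∷ noRepeat-++ (desc zero) (split-noRepeat s (desc ∘ suc))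
split-noRepeat (red s)        desc = noRepeat-++ (desc zero) (split-noRepeat s (desc ∘ suc))

-- `Runs c w g γ`: the current run of c ∷ w has g cells after c, and γ lists the
-- lengths of the later runs (maximal descending factors).
data Runs : Cell → List Cell → ℕ → List ℕ → Set where
  []   : ∀ {c} → Runs c [] 0 []
  down : ∀ {c d w g γ} → c ⊳ d → Runs d w g γ → Runs c (d ∷ w) (suc g) γ
  jump : ∀ {c d w g γ} → ¬ c ⊳ d → Runs d w g γ → Runs c (d ∷ w) 0 (suc g ∷ γ)

runsFrom : ∀ c w → ∃ λ g → ∃ λ γ → Runs c w g γ
runsFrom c [] = 0 , [] , []
runsFrom c (d ∷ w) with runsFrom d w | column d <? column c
... | g , γ , r | yes gt = suc g , γ , down gt r
... | g , γ , r | no ¬gt = 0 , suc g ∷ γ , jump ¬gt r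

runs : List Cell → List ℕ
runs []      = []
runs (c ∷ w) = let g , γ , _ = runsFrom c w in suc g ∷ γ

runs-positive : ∀ w → IsComposition (runs w)
runs-positive []      = []
runs-positive (c ∷ w) = s≤s z≤n ∷ later (proj₂ (proj₂ (runsFrom c w)))
  where
  later : ∀ {c w g γ} → Runs c w g γ → IsComposition γ
  later []         = []
  later (down _ r) = later r
  later (jump _ r) = s≤s z≤n ∷ later r

-- A run ends only where the column fails to drop, and that never happens inside a descending piece;
-- so the piece stays within the current run.
runs-++ : ∀ {c cs w g γ} → Descending (c ∷ cs) → Runs c (cs ++ w) g γ →
  ∃ λ g′ → g ≡ length cs + g′ × Runs (final c cs) w g′ γ
runs-++ [-]      r           = _ , refl , r
runs-++ (gt ∷ l) (down _ r)  with g′ , refl , r′ ← runs-++ l r = g′ , refl , r′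
runs-++ (gt ∷ l) (jump ¬gt r) = contradiction gt ¬gt

runs-cut : ∀ m {c w g γ} → Runs c w (m + g) γ →
  ∃ λ cs → ∃ λ w′ → w ≡ cs ++ w′ × length cs ≡ m × Descending (c ∷ cs) × Runs (final c cs) w′ g γ
runs-cut zero    r           = [] , _ , refl , refl , [-] , r
runs-cut (suc m) (down gt r) with cs , w′ , refl , refl , l , r′ ← runs-cut m r =
  _ ∷ cs , w′ , refl , refl , gt ∷ l , r′

-- A black piece continues the current run or begins the next one, according to whether the column
-- drops at its first cell. A red piece re-reads the last cell, so it always continues the current
-- run and adds one cell fewer than its length. Hence the leading black entries of a glide and its
-- correction by the excess.
split⇒parse-inside : ∀ {p n} {b : WeakKomposition n} {w C g γ} → Split (just p) b w C →
  (∀ v → Descending (lookup C v)) → Runs p w g γ → Parse (just g) γ (Vec.toList b)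
split⇒parse-inside done         desc []         = end used
split⇒parse-inside (nil s)      desc r          = nil (split⇒parse-inside s (desc ∘ suc) r)
split⇒parse-inside (black _ s)  desc (down _ r) with g′ , refl , r′ ← runs-++ (desc zero) r =
  black (split⇒parse-inside s (desc ∘ suc) r′)
split⇒parse-inside (black _ s)  desc (jump _ r) with g′ , refl , r′ ← runs-++ (desc zero) r =
  start used (split⇒parse-inside s (desc ∘ suc) r′)
split⇒parse-inside (red s)      desc r          with g′ , refl , r′ ← runs-++ (desc zero) r =
  red (split⇒parse-inside s (desc ∘ suc) r′)

split⇒parse : ∀ {n} {b : WeakKomposition n} {w C} → Split nothing b w C →
  (∀ v → Descending (lookup C v)) → Parse nothing (runs w) (Vec.toList b)
split⇒parse done    desc = end fresh
split⇒parse (nil s) desc = nil (split⇒parse s (desc ∘ suc))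
split⇒parse (black {w = w} {c = c} {cs} _ s) desc with runsFrom c (cs ++ w)
... | g , γ , r with g′ , refl , r′ ← runs-++ (desc zero) r =
  start fresh (split⇒parse-inside s (desc ∘ suc) r′)

descending-∷ : ∀ {n} {C : Code n} {cs} → Descending cs → (∀ v → Descending (lookup C v)) →
  ∀ v → Descending (lookup (cs ∷ C) v)
descending-∷ d ds zero    = d
descending-∷ d ds (suc v) = ds v

Splitting : Maybe Cell → ∀ {n} → WeakKomposition n → List Cell → Set
Splitting p {n} b w = ∃ λ (C : Code n) → (∀ v → Descending (lookup C v)) × Split p b w C

-- The remainder g of the part is the remainder of the current run, so the next piece of the
-- prescribed length is descending. `NoRepeat` provides the inequality required of black pieces.
parse⇒split-inside : ∀ {p n} (b : WeakKomposition n) {w g γ} → Parse (just g) γ (Vec.toList b) →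
  Runs p w g γ → NoRepeat (just p) w → Splitting (just p) b w
parse⇒split-inside [] (end used) [] _ = [] , (λ ()) , done
parse⇒split-inside (nil ∷ b) (nil q) r nr =
  let C , desc , s = parse⇒split-inside b q r nr in [] ∷ C , descending-∷ [] desc , nil s
parse⇒split-inside (coloured black m ∷ b) (black q) (down _ r) (≢ ∷ nr)
  with cs , w′ , refl , refl , l , r′ ← runs-cut m r =
  let C , desc , s = parse⇒split-inside b q r′ (noRepeat-drop cs nr) in
  _ ∷ C , descending-∷ l desc , black ≢ s
parse⇒split-inside (coloured black m ∷ b) (start used q) (jump _ r) (≢ ∷ nr)
  with cs , w′ , refl , refl , l , r′ ← runs-cut m r =
  let C , desc , s = parse⇒split-inside b q r′ (noRepeat-drop cs nr) in
  _ ∷ C , descending-∷ l desc , black ≢ s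
parse⇒split-inside (coloured red m ∷ b) (red q) r nr
  with cs , w′ , refl , refl , l , r′ ← runs-cut m r =
  let C , desc , s = parse⇒split-inside b q r′ (noRepeat-drop cs nr) in
  _ ∷ C , descending-∷ l desc , red s

parse⇒split : ∀ {n} (b : WeakKomposition n) {w} → Parse nothing (runs w) (Vec.toList b) →
  NoRepeat nothing w → Splitting nothing b w
parse⇒split [] {[]} (end fresh) _ = [] , (λ ()) , done
parse⇒split (nil ∷ b) (nil q) nr =
  let C , desc , s = parse⇒split b q nr in [] ∷ C , descending-∷ [] desc , nil s
parse⇒split (coloured black m ∷ b) {c ∷ w} q (≢ ∷ nr) with runsFrom c w
parse⇒split (coloured black m ∷ b) {c ∷ w} (start fresh q) (≢ ∷ nr) | _ , _ , r
  with cs , w′ , refl , refl , l , r′ ← runs-cut m r =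
  let C , desc , s = parse⇒split-inside b q r′ (noRepeat-drop cs nr) in
  _ ∷ C , descending-∷ l desc , black ≢ s

-- Position k ≥ 1 of p, w₁, w₂, … is that of w_k; position 0 is that of p.
At : Maybe Cell → List Cell → ℕ → Cell → Set
At p w       zero    c = p ≡ just c
At p []      (suc k) c = ⊥
At p (d ∷ w) (suc k) c = At (just d) w k c

at-functional : ∀ p w k {c d} → At p w k c → At p w k d → c ≡ d
at-functional p w       zero    h h′ = Maybe.just-injective (trans (sym h) h′)
at-functional p (d ∷ w) (suc k) h h′ = at-functional (just d) w k h h′

-- The interval of positions covered by piece v. A red piece also covers position 0, relative to
-- what has been read, which is the last position of the preceding nonempty piece: one position can
-- thus carry several values.
Occurs : ∀ {n} → WeakKomposition n → Fin n → ℕ → Set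
Occurs (nil ∷ b)              zero    k = ⊥
Occurs (coloured black m ∷ b) zero    k = 1 ≤ k × k ≤ suc m
Occurs (coloured red m ∷ b)   zero    k = k ≤ m
Occurs (nil ∷ b)              (suc v) k = Occurs b v k
Occurs (coloured black m ∷ b) (suc v) k = ∃ λ k′ → k ≡ suc m + k′ × Occurs b v k′
Occurs (coloured red m ∷ b)   (suc v) k = ∃ λ k′ → k ≡ m + k′ × Occurs b v k′

occurs-mono : ∀ {n} (b : WeakKomposition n) {v v′ k k′} → v Fin.< v′ →
  Occurs b v k → Occurs b v′ k′ → k ≤ k′
occurs-mono (nil ∷ b)              {suc v} {suc v′} (s≤s lt) o o′ = occurs-mono b lt o o′
occurs-mono (coloured black m ∷ b) {zero}  {suc v′} _ (_ , le) (k′ , refl , _) = ≤-trans le (m≤m+n (suc m) k′)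
occurs-mono (coloured black m ∷ b) {suc v} {suc v′} (s≤s lt) (_ , refl , o) (_ , refl , o′) =
  +-monoʳ-≤ (suc m) (occurs-mono b lt o o′)
occurs-mono (coloured red m ∷ b)   {zero}  {suc v′} _ le (k′ , refl , _) = ≤-trans le (m≤m+n m k′)
occurs-mono (coloured red m ∷ b)   {suc v} {suc v′} (s≤s lt) (_ , refl , o) (_ , refl , o′) =
  +-monoʳ-≤ m (occurs-mono b lt o o′)

at-++ : ∀ c cs w k d → At (just c) (cs ++ w) (length cs + k) d ≡ At (just (final c cs)) w k d
at-++ c []       w k d = refl
at-++ c (_ ∷ cs) w k d = at-++ _ cs w k d

at-segment⁺ : ∀ c cs w {d} → d ∈ c ∷ cs → ∃ λ k → k ≤ length cs × At (just c) (cs ++ w) k d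
at-segment⁺ c cs        w (here refl) = 0 , z≤n , refl
at-segment⁺ c (c′ ∷ cs) w (there d∈)  =
  let k , le , h = at-segment⁺ c′ cs w d∈ in suc k , s≤s le , h

at-segment⁻ : ∀ c cs w {k d} → k ≤ length cs → At (just c) (cs ++ w) k d → d ∈ c ∷ cs
at-segment⁻ c cs        w {zero}  _        refl = here refl
at-segment⁻ c (c′ ∷ cs) w {suc k} (s≤s le) h    = there (at-segment⁻ c′ cs w le h)

at-descending : ∀ c cs w {k k′ d d′} → AllPairs _⊳_ (c ∷ cs) → k < k′ → k′ ≤ length cs →
  At (just c) (cs ++ w) k d → At (just c) (cs ++ w) k′ d′ → d ⊳ d′
at-descending c (c′ ∷ cs) w {zero}  {suc k′} (gt ∷ _) _ (s≤s le) refl h′ =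
  All.lookup gt (at-segment⁻ c′ cs w le h′)
at-descending c (c′ ∷ cs) w {suc k} {suc k′} (_ ∷ l) (s≤s lt) (s≤s le) h h′ =
  at-descending c′ cs w l lt le h h′

split-occurs⁺ : ∀ {p n} {b : WeakKomposition n} {w C} → Split p b w C → ∀ v {c} →
  c ∈ lookup C v → ∃ λ k → Occurs b v k × At p w k c
split-occurs⁺ (nil s) (suc v) c∈ = split-occurs⁺ s v c∈
split-occurs⁺ (black {w = w} {c = c} {cs} _ s) zero c∈ =
  let k , le , h = at-segment⁺ c cs w c∈ in suc k , (s≤s z≤n , s≤s le) , h
split-occurs⁺ (black {w = w} {c = c} {cs} _ s) (suc v) c∈ =
  let k , o , h = split-occurs⁺ s v c∈ in
  suc (length cs + k) , (k , refl , o) , subst id (sym (at-++ c cs w k _)) h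
split-occurs⁺ (red {w = w} {c = c} {cs} s) zero c∈ =
  let k , le , h = at-segment⁺ c cs w c∈ in k , le , h
split-occurs⁺ (red {w = w} {c = c} {cs} s) (suc v) c∈ =
  let k , o , h = split-occurs⁺ s v c∈ in
  length cs + k , (k , refl , o) , subst id (sym (at-++ c cs w k _)) h

split-occurs⁻ : ∀ {p n} {b : WeakKomposition n} {w C} → Split p b w C → ∀ v {k c} →
  Occurs b v k → At p w k c → c ∈ lookup C v
split-occurs⁻ (nil s) (suc v) o h = split-occurs⁻ s v o h
split-occurs⁻ (black {w = w} {c = c} {cs} _ s) zero {suc k} (_ , s≤s le) h = at-segment⁻ c cs w le h
split-occurs⁻ (black {w = w} {c = c} {cs} _ s) (suc v) (k , refl , o) h =
  split-occurs⁻ s v o (subst id (at-++ c cs w k _) h)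
split-occurs⁻ (red {w = w} {c = c} {cs} s) zero le h = at-segment⁻ c cs w le h
split-occurs⁻ (red {w = w} {c = c} {cs} s) (suc v) (k , refl , o) h =
  split-occurs⁻ s v o (subst id (at-++ c cs w k _) h)

<⇒∃+suc : ∀ {m n} → m < n → ∃ λ k → n ≡ m + suc k
<⇒∃+suc {m} lt = let k , eq = m≤n⇒∃[o]m+o≡n lt in k , trans (sym eq) (sym (+-suc m k))

split-covers : ∀ {p n} {b : WeakKomposition n} {w C} → Split p b w C → ∀ k {c} →
  At p w (suc k) c → ∃ λ v → Occurs b v (suc k)
split-covers (nil s) k h = let v , o = split-covers s k h in suc v , o
split-covers (black {w = w} {c = c} {cs} _ s) k h with k ≤? length cs
... | yes le = zero , s≤s z≤n , s≤s le
... | no ¬le with k′ , refl ← <⇒∃+suc (≰⇒> ¬le) =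
  let v , o = split-covers s k′ (subst id (at-++ c cs w (suc k′) _) h) in
  suc v , suc k′ , refl , o
split-covers (red {w = w} {c = c} {cs} s) k {d} h with suc k ≤? length cs
... | yes le = zero , le
... | no ¬le with k′ , eq′ ← <⇒∃+suc (≰⇒> ¬le) =
  let v , o = split-covers s k′ (subst id (at-++ c cs w (suc k′) _)
                (subst (λ k → At (just c) (cs ++ w) k d) eq′ h)) in
  suc v , suc k′ , eq′ , o

split-descending : ∀ {p n} {b : WeakKomposition n} {w C} → Split p b w C →
  (∀ v → Descending (lookup C v)) → ∀ v {k k′ c c′} → Occurs b v k → Occurs b v k′ → k < k′ →
  At p w k c → At p w k′ c′ → c ⊳ c′
split-descending (nil s) desc (suc v) o o′ lt h h′ = split-descending s (desc ∘ suc) v o o′ lt h h′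
split-descending (black {w = w} {c = c} {cs} _ s) desc zero {suc k} {suc k′} o (_ , s≤s le) (s≤s lt) h h′ =
  at-descending c cs w (descending⇒allPairs (desc zero)) lt le h h′
split-descending (black {w = w} {c = c} {cs} _ s) desc (suc v) (k , refl , o) (k′ , refl , o′) lt h h′ =
  split-descending s (desc ∘ suc) v o o′ (+-cancelˡ-< (suc (length cs)) k k′ lt)
    (subst id (at-++ c cs w k _) h) (subst id (at-++ c cs w k′ _) h′)
split-descending (red {w = w} {c = c} {cs} s) desc zero o le lt h h′ =
  at-descending c cs w (descending⇒allPairs (desc zero)) lt le h h′
split-descending (red {w = w} {c = c} {cs} s) desc (suc v) (k , refl , o) (k′ , refl , o′) lt h h′ =
  split-descending s (desc ∘ suc) v o o′ (+-cancelˡ-< (length cs) k k′ lt)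
    (subst id (at-++ c cs w k _) h) (subst id (at-++ c cs w k′ _) h′)

-- Semistandardness as a property of the word

-- The default 0 makes all rows beyond the last part empty, so `Shape` needs no separate bound on
-- the row.
nth : List ℕ → ℕ → ℕ
nth []      _       = 0
nth (x ∷ _) zero    = x
nth (_ ∷ l) (suc r) = nth l r

-- Skipping the empty rows makes the row labels of cells depend on a⁺ only.
rank : ∀ {n} → Vec ℕ n → Fin n → ℕ
rank (_ ∷ a)     zero    = 0
rank (zero ∷ a)  (suc i) = rank a i
rank (suc _ ∷ a) (suc i) = suc (rank a i)

nth-rank : ∀ {n} (a : Vec ℕ n) i → 0 < lookup a i → nth (positivePart a) (rank a i) ≡ lookup a i
nth-rank (suc x ∷ a) zero    _   = refl
nth-rank (zero ∷ a)  (suc i) pos = nth-rank a i pos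
nth-rank (suc x ∷ a) (suc i) pos = nth-rank a i pos

rank-mono : ∀ {n} (a : Vec ℕ n) {i j} → 0 < lookup a i → i Fin.< j → rank a i < rank a j
rank-mono (suc x ∷ a) {zero}  {suc j} _   _        = s≤s z≤n
rank-mono (zero ∷ a)  {suc i} {suc j} pos (s≤s lt) = rank-mono a pos lt
rank-mono (suc x ∷ a) {suc i} {suc j} pos (s≤s lt) = s≤s (rank-mono a pos lt)

unrank : ∀ {n} (a : Vec ℕ n) r → 0 < nth (positivePart a) r → ∃ λ i → rank a i ≡ r × 0 < lookup a i
unrank (zero ∷ a)  r       pos = let i , eq , pos′ = unrank a r pos in suc i , eq , pos′
unrank (suc x ∷ a) zero    pos = zero , refl , s≤s z≤n
unrank (suc x ∷ a) (suc r) pos = let i , eq , pos′ = unrank a r pos in suc i , cong suc eq , pos′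

-- S2 entry by entry, and the effect of a move

module _ {n : ℕ} {A B : Subset n} where

  ≽-intro : (∀ {x y} → x ∈ₛ A → y ∈ₛ B → y Fin.≤ x) → A ≽ B
  ≽-intro h x y (x∈ , _) (y∈ , _) = h x∈ y∈

  -- The two given elements show that A and B are nonempty, so the minimum and the maximum exist and
  -- lie between x and y.
  ≽-elim : A ≽ B → ∀ {x y} → x ∈ₛ A → y ∈ₛ B → y Fin.≤ x
  ≽-elim A≽B {x} {y} x∈ y∈ =
    let l , l∈ , min = minimum (Subset._∈? A) (x , x∈)
        g , g∈ , max = maximum (Subset._∈? B) (y , y∈)
    in ≤-trans (max y y∈) (≤-trans (A≽B l g (l∈ , min) (g∈ , max)) (min x x∈))

module _ {n : ℕ} (a : Vec ℕ n) where
  open Diagram a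

  move⁻ : ∀ F x b b′ {d y} → y ∈ₛ move F x b b′ d → y ∈ₛ F d ⊎ (y ≡ x × d ≡ b′)
  move⁻ F x b b′ {d} y∈ with d ≟ᵇ b′ | d ≟ᵇ b
  ... | no _ | no _  = inj₁ y∈
  ... | no _ | yes _ = inj₁ (Subset.p─q⊆p (F d) ⁅ x ⁆ y∈)
  ... | yes eq | no _ with Subset.x∈p∪q⁻ (F d) ⁅ x ⁆ y∈
  ... | inj₁ y∈F = inj₁ y∈F
  ... | inj₂ y∈x = inj₂ (Subset.x∈⁅y⁆⇒x≡y x y∈x , eq)
  move⁻ F x b b′ {d} y∈ | yes eq | yes _ with Subset.x∈p∪q⁻ (F d - x) ⁅ x ⁆ y∈
  ... | inj₁ y∈F = inj₁ (Subset.p─q⊆p (F d) ⁅ x ⁆ y∈F)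
  ... | inj₂ y∈x = inj₂ (Subset.x∈⁅y⁆⇒x≡y x y∈x , eq)

  moved : ∀ F x b b′ → x ∈ₛ move F x b b′ b′
  moved F x b b′ with b′ ≟ᵇ b′
  ... | no ne = contradiction refl ne
  ... | yes _ = Subset.x∈p∪q⁺ (inj₂ (Subset.x∈⁅x⁆ x))

  move-other : ∀ F x b b′ {d y} → d ≢ b → y ∈ₛ F d → y ∈ₛ move F x b b′ d
  move-other F x b b′ {d} d≢b y∈ with d ≟ᵇ b′ | d ≟ᵇ b
  ... | _     | yes eq = contradiction eq d≢b
  ... | no _  | no _   = y∈
  ... | yes _ | no _   = Subset.x∈p∪q⁺ (inj₁ y∈)

-- Along the occurrences of a box its entries increase, so its last occurrence is the position of
-- its anchor.
Last : List Cell → ℕ → Cell → Set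
Last w k c = At nothing w k c × (∀ l → At nothing w l c → l ≤ k)

last-unique : ∀ {w k l c} → Last w k c → Last w l c → k ≡ l
last-unique (h , max) (h′ , max′) = ≤-antisym (max′ _ h) (max _ h′)

Shape : List ℕ → Cell → Set
Shape α (r , c) = c < nth α r

-- The semistandardness conditions on a filling of the rows of α, expressed by
-- its word only.
record Good (α : List ℕ) (w : List Cell) : Set where
  field
    complete : ∀ {c} → Shape α c → ∃ λ k → At nothing w k c
    shape    : ∀ {k c} → At nothing w k c → Shape α c
    rows     : ∀ {r c k l} → At nothing w k (r , c) → At nothing w l (r , suc c) → l < k
    triples  : ∀ {r c t c′ k l m} →
               (r < t × c′ ≡ suc c × nth α t ≤ nth α r) ⊎ (t < r × c′ ≡ c × nth α t < nth α r) →
               Last w k (r , suc c) → Last w l (r , c) → Last w m (t , c′) → m < k ⊎ l < m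
    -- S4: an occurrence before the last carries a free entry. The two conditions on p and on the
    -- cells to the right say that the entry could move under the anchor of row r′.
    free     : ∀ {r r′ c k m p} → At nothing w k (r , c) → Last w m (r , c) → k < m →
               Last w p (r′ , c) → k < p → (∀ j → At nothing w j (r′ , suc c) → j < k) → m ≤ p
    -- All that is left of S5 once the heights of the rows are forgotten: the anchors of the first
    -- column increase upwards.
    columns  : ∀ {r t k m} → r < t → Last w k (r , 0) → Last w m (t , 0) → k < m

-- Values compared through positions

module Entries {n : ℕ} {b : WeakKomposition n} {w : List Cell} {C : Code n}
  (s : Split nothing b w C) (desc : ∀ v → Descending (lookup C v)) where

  Entry∈ : Fin n → Cell → Set
  Entry∈ x c = c ∈ lookup C x

  entry∈? : ∀ c x → Dec (Entry∈ x c)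
  entry∈? c x = DecMembership._∈?_ _≟ᶜᵉ_ c (lookup C x)

  Top : Fin n → Cell → Set
  Top x c = Entry∈ x c × (∀ y → Entry∈ y c → y Fin.≤ x)

  Pos : Fin n → Cell → ℕ → Set
  Pos x c k = Occurs b x k × At nothing w k c

  entry⇒pos : ∀ {x c} → Entry∈ x c → ∃ λ k → Pos x c k
  entry⇒pos {x} = split-occurs⁺ s x

  pos⇒entry : ∀ {x c k} → Pos x c k → Entry∈ x c
  pos⇒entry {x} (o , h) = split-occurs⁻ s x o h

  at⇒pos : ∀ {c k} → At nothing w k c → ∃ λ x → Pos x c k
  at⇒pos {k = suc k} h = let x , o = split-covers s k h in x , o , h

  pos-functional : ∀ {x y c d k} → Pos x c k → Pos y d k → c ≡ d
  pos-functional {k = k} (_ , h) (_ , h′) = at-functional nothing w k h h′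

  pos-≤ : ∀ {x y c d k l} → Pos x c k → Pos y d l → k < l → x Fin.≤ y
  pos-≤ (o , _) (o′ , _) k<l = ≮⇒≥ λ y<x → <⇒≱ k<l (occurs-mono b y<x o′ o)

  -- Were the values equal, both cells would lie in one descending piece, where the earlier cell is
  -- further right.
  pos-< : ∀ {x y c d k l} → Pos x c k → Pos y d l → k < l → ¬ c ⊳ d → x Fin.< y
  pos-< {x} {y} p@(o , h) p′@(o′ , h′) k<l ¬gt with Fin.<-cmp x y
  ... | tri< lt _ _   = lt
  ... | tri≈ _ refl _ = contradiction (split-descending s desc x o o′ k<l h h′) ¬gt
  ... | tri> _ _ gt   = contradiction (pos-≤ p p′ k<l) (<⇒≱ gt)

  -- Pieces of different values can meet in one position, but that position then holds the same box
  -- for both.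
  <-pos : ∀ {x y c d k l} → Pos x c k → Pos y d l → c ≢ d → x Fin.< y → k < l
  <-pos p@(o , h) p′@(o′ , h′) c≢d x<y =
    ≤∧≢⇒< (occurs-mono b x<y o o′) λ { refl → c≢d (pos-functional p p′) }

  adjacent-≢ : ∀ {r t c : ℕ} → (r , c) ≢ (t , suc c)
  adjacent-≢ ()

  -- Equal values are listed from right to left, so the cell of the right-hand column comes first
  -- also in case of a tie.
  ≤-pos : ∀ {x y r t c k l} → Pos x (r , c) k → Pos y (t , suc c) l → y Fin.≤ x → l < k
  ≤-pos {c = c} {k} {l} p p′ y≤x with <-cmp k l
  ... | tri< k<l _ _  = contradiction y≤x (<⇒≱ (pos-< p p′ k<l (<-asym (n<1+n c))))
  ... | tri≈ _ refl _ = contradiction (pos-functional p p′) adjacent-≢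
  ... | tri> _ _ l<k  = l<k

  same-pos : ∀ {x y c k l} → Pos x c k → Pos y c l → x Fin.≤ y → k ≤ l
  same-pos p p′ x≤y = ≮⇒≥ λ l<k → <⇒≱ (pos-< p′ p l<k (<-irrefl refl)) x≤y

  top-exists : ∀ {x c} → Entry∈ x c → ∃ λ y → Top y c
  top-exists {x} {c} e = maximum (entry∈? c) (x , e)

  top⇒last : ∀ {x c k} → Top x c → Pos x c k → Last w k c
  top⇒last {c = c} (_ , max) p = proj₂ p , λ l h →
    let y , p′ = at⇒pos {c} {l} h in same-pos p′ p (max y (pos⇒entry p′))

  last⇒top : ∀ {k c} → Last w k c → ∃ λ x → Top x c × Pos x c k
  last⇒top {k} {c} last@(h , _) =
    let _ , p      = at⇒pos {c} {k} h
        x , top    = top-exists (pos⇒entry p)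
        l , p′     = entry⇒pos (proj₁ top)
    in x , top , subst (Pos x c) (last-unique (top⇒last top p′) last) p′

-- Boxes of D(a) as cells of α

module Cells {n : ℕ} (a : Vec ℕ n) {α : List ℕ} (a⁺≡α : positivePart a ≡ α) where
  open Diagram a

  cell : Box → Cell
  cell (i , c) = rank a i , toℕ c

  row-positive : ∀ (b : Box) → 0 < lookup a (row b)
  row-positive (i , c) = ≤-trans (s≤s z≤n) (Fin.toℕ<n c)

  row-length : ∀ b → nth α (rank a (row b)) ≡ rowLength b
  row-length b = trans (cong (λ α → nth α (rank a (row b))) (sym a⁺≡α)) (nth-rank a (row b) (row-positive b))

  cell-shape : ∀ b → Shape α (cell b)
  cell-shape b = subst (col b <_) (sym (row-length b)) (Fin.toℕ<n (proj₂ b))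

  box : ∀ {c} → Shape α c → ∃ λ b → cell b ≡ c
  box {r , c} lt with i , refl , pos ← unrank a r (subst (λ α → 0 < nth α r) (sym a⁺≡α) (≤-trans (s≤s z≤n) lt)) =
    (i , fromℕ< lt′) , cong (rank a i ,_) (Fin.toℕ-fromℕ< lt′)
    where
    lt′ : c < lookup a i
    lt′ = subst (c <_) (trans (cong (λ α → nth α (rank a i)) (sym a⁺≡α)) (nth-rank a i pos)) lt

  row-<⁺ : ∀ b b′ → row b Fin.< row b′ → rank a (row b) < rank a (row b′)
  row-<⁺ b b′ = rank-mono a (row-positive b)

  row-injective : ∀ b b′ → rank a (row b) ≡ rank a (row b′) → row b ≡ row b′
  row-injective b b′ eq with Fin.<-cmp (row b) (row b′)
  ... | tri< lt _ _  = contradiction eq (<⇒≢ (row-<⁺ b b′ lt))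
  ... | tri≈ _ eq′ _ = eq′
  ... | tri> _ _ gt  = contradiction (sym eq) (<⇒≢ (row-<⁺ b′ b gt))

  row-<⁻ : ∀ b b′ → rank a (row b) < rank a (row b′) → row b Fin.< row b′
  row-<⁻ b b′ lt with Fin.<-cmp (row b) (row b′)
  ... | tri< lt′ _ _  = lt′
  ... | tri≈ _ eq _   = contradiction (cong (rank a) eq) (<⇒≢ lt)
  ... | tri> _ _ gt   = contradiction (row-<⁺ b′ b gt) (<-asym lt)

  cell-injective : ∀ {b b′} → cell b ≡ cell b′ → b ≡ b′
  cell-injective {b@(i , c)} {b′@(j , d)} eq with refl ← row-injective b b′ (cong proj₁ eq) =
    cong (i ,_) (Fin.toℕ-injective (cong proj₂ eq))

  adjacent⇒ : ∀ {l r} → Adjacent l r → cell r ≡ (rank a (row l) , suc (col l))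
  adjacent⇒ (req , ceq) = cong₂ _,_ (cong (rank a) (sym req)) ceq

  ⇒adjacent : ∀ {l r c t} → cell l ≡ (t , c) → cell r ≡ (t , suc c) → Adjacent l r
  ⇒adjacent {l} {r} refl eq = row-injective l r (sym (cong proj₁ eq)) , cong proj₂ eq

-- Semistandard fillings and good words

-- C is only assumed to hold the same entries as F, since the module serves both directions: once C
-- is computed from F, once F is decoded from C.
module Transfer {n : ℕ} (a : Vec ℕ n) {α : List ℕ} (a⁺≡α : positivePart a ≡ α)
  {b : WeakKomposition n} {w : List Cell} {C : Code n}
  (s : Split nothing b w C) (desc : ∀ v → Descending (lookup C v))
  (F : Diagram.Filling a)
  (F⇒C : ∀ {x} d → x ∈ₛ F d → Cells.cell a a⁺≡α d ∈ lookup C x)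
  (C⇒F : ∀ {x} d → Cells.cell a a⁺≡α d ∈ lookup C x → x ∈ₛ F d)
  where

  open Diagram a
  open Cells a a⁺≡α
  open Entries s desc

  anchor⇒top : ∀ {d x} → Anchor F d x → Top x (cell d)
  anchor⇒top {d} (x∈ , max) = F⇒C d x∈ , λ y → max y ∘ C⇒F d

  top⇒anchor : ∀ {d x} → Top x (cell d) → Anchor F d x
  top⇒anchor {d} (x∈ , max) = C⇒F d x∈ , λ y → max y ∘ F⇒C d

  position : ∀ {d x} → x ∈ₛ F d → ∃ λ k → Pos x (cell d) k
  position {d} x∈ = entry⇒pos (F⇒C d x∈)

  anchor-position : ∀ {d x} → Anchor F d x → ∃ λ k → Pos x (cell d) k × Last w k (cell d)
  anchor-position h = let k , p = position (proj₁ h) in k , p , top⇒last (anchor⇒top h) p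

  at⇒entry : ∀ {k} d → At nothing w k (cell d) → ∃ λ x → x ∈ₛ F d × Pos x (cell d) k
  at⇒entry {k} d h = let x , p = at⇒pos {cell d} {k} h in x , C⇒F d (pos⇒entry p) , p

  last⇒anchor : ∀ {k} d → Last w k (cell d) → ∃ λ x → Anchor F d x × Pos x (cell d) k
  last⇒anchor {k} d h = let x , top , p = last⇒top {k} {cell d} h in x , top⇒anchor top , p

  module _ (ss : Semistandard F) (boxed : ∀ {x c} → c ∈ lookup C x → ∃ λ d → cell d ≡ c) where
    open Semistandard ss

    at⇒box : ∀ {k c} → At nothing w k c → ∃ λ d → cell d ≡ c
    at⇒box {k} {c} h = boxed (pos⇒entry (proj₂ (at⇒pos {c} {k} h)))

    good-rows : ∀ {l r j k} → Adjacent l r → At nothing w k (cell l) → At nothing w j (cell r) → j < k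
    good-rows {l} {r} {j} {k} adj hk hj =
      let x , x∈ , p = at⇒entry {k} l hk
          y , y∈ , q = at⇒entry {j} r hj
      in ≤-pos p (subst (λ c → Pos y c j) (adjacent⇒ adj) q) (≽-elim (s2 l r adj) x∈ y∈)

    -- The weak inequality in an inversion triple is S2 for the adjacent boxes; only the alternative
    -- between γ < α and β < γ is carried over to positions.
    good-triples : ∀ {l r t j k m} → Triple l r t →
      Last w j (cell r) → Last w k (cell l) → Last w m (cell t) → m < j ⊎ k < m
    good-triples {l} {r} {t} {j} {k} {m} tr hj hk hm
      with x , x! , p ← last⇒anchor r hj | y , y! , q ← last⇒anchor l hk | z , z! , o ← last⇒anchor t hm
      with s3 l r t tr x y z x! y! z!
    ... | inj₁ (z<x , _) = inj₁ (<-pos o p (t≢r tr) z<x)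
      where
      t≢r : Triple l r t → cell t ≢ cell r
      t≢r (inj₁ (_ , lt , _)) eq = <⇒≢ (row-<⁺ r t lt) (sym (cong proj₁ eq))
      t≢r (inj₂ ((_ , ceq) , _ , teq , _)) eq = 1+n≢n (trans (sym ceq) (trans (sym (cong proj₂ eq)) teq))
    ... | inj₂ (_ , y<z) = inj₂ (<-pos q o (l≢t tr) y<z)
      where
      l≢t : Triple l r t → cell l ≢ cell t
      l≢t (inj₁ ((_ , ceq) , _ , teq , _)) eq = 1+n≢n (trans (sym ceq) (trans (sym teq) (sym (cong proj₂ eq))))
      l≢t (inj₂ (_ , lt , _)) eq = <⇒≢ (row-<⁺ t l lt) (sym (cong proj₁ eq))

    good-free : ∀ {d d′ k m p} → d ≢ d′ → col d′ ≡ col d → At nothing w k (cell d) → Last w m (cell d) → k < m →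
      Last w p (cell d′) → k < p → (∀ {j} e → Adjacent d′ e → At nothing w j (cell e) → j < k) → m ≤ p
    good-free {d} {d′} {k} {m} {p} d≢d′ ceq hk hm k<m hp k<p hyp
      with x , x∈ , xk ← at⇒entry {k} d hk | y , y! , ym ← last⇒anchor d hm | z , z! , zp ← last⇒anchor d′ hp =
      ≮⇒≥ λ p<m → <⇒≱ (pos-< zp ym p<m (<-irrefl (sym ceq)))
        (s4 d x (x∈ , ¬x!) d′ ceq y z y! z! x<z s2-move)
      where
      ¬x! : ¬ Anchor F d x
      ¬x! h = <⇒≢ k<m (last-unique (top⇒last (anchor⇒top h) xk) hm)
      x<z : x Fin.< z
      x<z = pos-< xk zp k<p (<-irrefl ceq)
      -- Only right neighbours of d′ restrict the move: a left neighbour already dominates the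
      -- anchor z of d′, and x < z.
      s2-move : S2 (move F x d d′)
      s2-move l r adj = ≽-intro λ {u} {v} u∈ v∈ → cases (move⁻ a F x d d′ u∈) (move⁻ a F x d d′ v∈)
        where
        cases : ∀ {u v} → u ∈ₛ F l ⊎ (u ≡ x × l ≡ d′) → v ∈ₛ F r ⊎ (v ≡ x × r ≡ d′) → v Fin.≤ u
        cases (inj₁ u∈) (inj₁ v∈) = ≽-elim (s2 l r adj) u∈ v∈
        cases (inj₁ u∈) (inj₂ (refl , refl)) = ≤-trans (<⇒≤ x<z) (≽-elim (s2 l r adj) u∈ (proj₁ z!))
        cases (inj₂ (refl , refl)) (inj₁ v∈) = let j , vj = position v∈ in
          pos-≤ vj xk (hyp r adj (proj₂ vj))
        cases (inj₂ (refl , refl)) (inj₂ (refl , refl)) = ≤-refl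

    good-columns : ∀ {d e k m} → col d ≡ 0 → col e ≡ 0 → row d Fin.< row e →
      Last w k (cell d) → Last w m (cell e) → k < m
    good-columns {d} {e} d0 e0 lt hk hm
      with x , x! , xk ← last⇒anchor d hk | y , y! , ym ← last⇒anchor e hm =
      <-pos xk ym (λ eq → <⇒≢ (row-<⁺ d e lt) (cong proj₁ eq))
        (subst₂ Fin._<_ (sym (s5 d d0 x x!)) (sym (s5 e e0 y y!)) lt)

    good : Good α w
    good = record
      { complete = λ sh → let d , eq = box sh
                              x , x∈ = nonempty d
                              k , p  = position x∈
                          in k , subst (At nothing w k) eq (proj₂ p)
      ; shape    = λ {k} {c} h → let d , eq = at⇒box {k} {c} h in subst (Shape α) eq (cell-shape d)
      ; rows     = rows
      ; triples  = triples
      ; free     = free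
      ; columns  = columns
      }
      where
      rows : ∀ {r c k l} → At nothing w k (r , c) → At nothing w l (r , suc c) → l < k
      rows {r} {c} {k} {l} hk hl
        with d , refl ← at⇒box {k} {r , c} hk | e , eq ← at⇒box {l} {r , suc c} hl =
        good-rows (⇒adjacent refl eq) hk (subst (At nothing w l) (sym eq) hl)
      triples : ∀ {r c t c′ k l m} →
        (r < t × c′ ≡ suc c × nth α t ≤ nth α r) ⊎ (t < r × c′ ≡ c × nth α t < nth α r) →
        Last w k (r , suc c) → Last w l (r , c) → Last w m (t , c′) → m < k ⊎ l < m
      triples {r} {c} {t} {c′} {k} {l} {m} cond hk hl hm
        with d , refl ← at⇒box {l} {r , c} (proj₁ hl) | e , eq ← at⇒box {k} {r , suc c} (proj₁ hk)
           | f , refl ← at⇒box {m} {t , c′} (proj₁ hm) =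
        good-triples (triple cond) (subst (Last w k) (sym eq) hk) hl hm
        where
        adj : Adjacent d e
        adj = ⇒adjacent refl eq
        triple :
          (rank a (row d) < rank a (row f) × col f ≡ suc (col d) ×
            nth α (rank a (row f)) ≤ nth α (rank a (row d))) ⊎
          (rank a (row f) < rank a (row d) × col f ≡ col d ×
            nth α (rank a (row f)) < nth α (rank a (row d))) →
          Triple d e f
        triple (inj₁ (lt , ceq , le)) = inj₁ (adj , subst (Fin._< row f) (proj₁ adj) (row-<⁻ d f lt) ,
          trans ceq (sym (proj₂ adj)) ,
          subst (rowLength f ≤_) (cong (lookup a) (proj₁ adj)) (subst₂ _≤_ (row-length f) (row-length d) le))
        triple (inj₂ (lt , ceq , le)) = inj₂ (adj , row-<⁻ f d lt , ceq ,
          subst₂ _<_ (row-length f) (row-length d) le)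
      free : ∀ {r r′ c k m p} → At nothing w k (r , c) → Last w m (r , c) → k < m →
        Last w p (r′ , c) → k < p → (∀ j → At nothing w j (r′ , suc c) → j < k) → m ≤ p
      free {r} {r′} {c} {k} {m} {p} hk hm k<m hp k<p hyp with r ≟ r′
      ... | yes refl = ≤-reflexive (last-unique hm hp)
      ... | no r≢r′ with d , refl ← at⇒box {k} {r , c} hk | d′ , eq ← at⇒box {p} {r′ , c} (proj₁ hp) =
        good-free {d} {d′} (λ { refl → r≢r′ (cong proj₁ eq) }) (cong proj₂ eq) hk hm k<m
          (subst (Last w p) (sym eq) hp) k<p
          λ {j} e adj h → hyp j (subst (At nothing w j)
            (trans (adjacent⇒ adj) (cong (λ (r , c) → r , suc c) eq)) h)
      columns : ∀ {r t k m} → r < t → Last w k (r , 0) → Last w m (t , 0) → k < m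
      columns {r} {t} {k} {m} lt hk hm
        with d , eq ← at⇒box {k} {r , 0} (proj₁ hk) | e , eq′ ← at⇒box {m} {t , 0} (proj₁ hm) =
        good-columns (cong proj₂ eq) (cong proj₂ eq′)
          (row-<⁻ d e (subst₂ _<_ (sym (cong proj₁ eq)) (sym (cong proj₁ eq′)) lt))
          (subst (Last w k) (sym eq) hk) (subst (Last w m) (sym eq′) hm)

  module _ (g : Good α w) (s5 : S5 F) where
    open Good g

    -- Equal values lie in one descending piece, so at different positions they are in different
    -- columns, and one position holds one box.
    semistandard-s1 : S1 F
    semistandard-s1 d e ceq d≢e x (x∈d , x∈e)
      with k , p@(o , h) ← position x∈d | l , q@(o′ , h′) ← position x∈e with <-cmp k l
    ... | tri< lt _ _   = <-irrefl (sym ceq) (split-descending s desc x o o′ lt h h′)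
    ... | tri≈ _ refl _ = d≢e (cell-injective (pos-functional p q))
    ... | tri> _ _ gt   = <-irrefl ceq (split-descending s desc x o′ o gt h′ h)

    semistandard-≤ : ∀ {l r x y} → Adjacent l r → x ∈ₛ F l → y ∈ₛ F r → y Fin.≤ x
    semistandard-≤ {l} {r} {x} {y} adj x∈ y∈ with k , p ← position x∈ | j , q ← position y∈ =
      pos-≤ q p (rows (proj₂ p) (subst (At nothing w j) (adjacent⇒ adj) (proj₂ q)))

    triple-adjacent : ∀ {l r t} → Triple l r t → Adjacent l r
    triple-adjacent (inj₁ (adj , _)) = adj
    triple-adjacent (inj₂ (adj , _)) = adj

    -- In both types t is not to the right of r and l is not to the right of t, so precedence in the
    -- word yields the strict inequalities of an inversion triple.
    semistandard-s3 : S3 F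
    semistandard-s3 l r t tr x y z x! y! z!
      with j , p , hj ← anchor-position x! | k , q , hk ← anchor-position y! | m , o , hm ← anchor-position z!
      with triples (cond tr) (subst (Last w j) (adjacent⇒ (triple-adjacent tr)) hj) hk hm
      where
      cond : Triple l r t →
        (rank a (row l) < rank a (row t) × col t ≡ suc (col l) ×
          nth α (rank a (row t)) ≤ nth α (rank a (row l))) ⊎
        (rank a (row t) < rank a (row l) × col t ≡ col l ×
          nth α (rank a (row t)) < nth α (rank a (row l)))
      cond (inj₁ (h , lt , ceq , le)) = inj₁
        ( row-<⁺ l t (subst (Fin._< row t) (sym (proj₁ h)) lt) , trans ceq (proj₂ h)
        , subst₂ _≤_ (sym (row-length t)) (sym (row-length l))
            (subst (rowLength t ≤_) (cong (lookup a) (sym (proj₁ h))) le))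
      cond (inj₂ (h , lt , ceq , le)) = inj₂
        ( row-<⁺ t l lt , ceq , subst₂ _<_ (sym (row-length t)) (sym (row-length l)) le)
    ... | inj₁ m<j = inj₁ (pos-< o p m<j ¬gt , semistandard-≤ (triple-adjacent tr) (proj₁ y!) (proj₁ x!))
      where
      ¬gt : ¬ cell t ⊳ cell r
      ¬gt = ≤⇒≯ (col≤ tr)
        where
        col≤ : Triple l r t → col t ≤ col r
        col≤ (inj₁ (_ , _ , ceq , _)) = ≤-reflexive ceq
        col≤ (inj₂ (h , _ , ceq , _)) = ≤-trans (≤-reflexive ceq) (≤-trans (n≤1+n _) (≤-reflexive (sym (proj₂ h))))
    ... | inj₂ k<m = inj₂ (semistandard-≤ (triple-adjacent tr) (proj₁ y!) (proj₁ x!) , pos-< q o k<m ¬gt)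
      where
      ¬gt : ¬ cell l ⊳ cell t
      ¬gt = ≤⇒≯ (col≤ tr)
        where
        col≤ : Triple l r t → col l ≤ col t
        col≤ (inj₁ (h , _ , ceq , _)) = ≤-trans (n≤1+n _) (≤-reflexive (sym (trans ceq (proj₂ h))))
        col≤ (inj₂ (_ , _ , ceq , _)) = ≤-reflexive (sym ceq)

    semistandard-s4 : S4 F
    semistandard-s4 d x (x∈ , _) d′ ceq y z y! z! x<z s2-move with d ≟ᵇ d′
    ... | yes refl = proj₂ z! y (proj₁ y!)
    ... | no d≢d′
      with k , xk ← position x∈ | m , ym , hm ← anchor-position y! | p , zp , hp ← anchor-position z! = y≤z
      where
      cell-≢ : cell d ≢ cell d′
      cell-≢ = d≢d′ ∘ cell-injective
      k<p : k < p
      k<p = <-pos xk zp cell-≢ x<z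
      -- After the move x lies in d′, while the right neighbour e, being in another column than d,
      -- keeps its entries; S2 compares the two.
      right : ∀ j → At nothing w j (rank a (row d′) , suc (col d)) → j < k
      right j h
        with e , eq ← box (shape {j} h)
        with v , v∈ , vj ← at⇒entry {j} e (subst (At nothing w j) (sym eq) h) =
        ≤-pos xk (subst (λ c → Pos v c j) eq vj)
          (≽-elim (s2-move d′ e (⇒adjacent (cong (rank a (row d′) ,_) ceq) eq)) (moved a F x d d′)
            (move-other a F x d d′ (λ { refl → 1+n≢n (sym (cong proj₂ eq)) }) v∈))
      m≤p : m ≤ p
      m≤p with m≤n⇒m<n∨m≡n (same-pos xk ym (proj₂ y! x x∈))
      ... | inj₁ k<m  = free (proj₂ xk) hm k<m (subst (λ c → Last w p (rank a (row d′) , c)) ceq hp) k<p right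
      -- A free entry shares the position of its anchor when the box was met several times in a row;
      -- then k < p already gives the claim.
      ... | inj₂ refl = <⇒≤ k<p
      y≤z : y Fin.≤ z
      y≤z = pos-≤ ym zp (≤∧≢⇒< m≤p λ { refl → cell-≢ (pos-functional ym zp) })

    semistandard : Semistandard F
    semistandard = record
      { nonempty = λ d → let k , h = complete (cell-shape d)
                             x , x∈ , _ = at⇒entry {k} d h
                         in x , x∈
      ; s1 = semistandard-s1
      ; s2 = λ l r adj → ≽-intro (semistandard-≤ adj)
      ; s3 = semistandard-s3
      ; s4 = semistandard-s4
      ; s5 = s5
      }

-- The code of a filling

lookup-ext : ∀ {A : Set} {k} {u v : Vec A k} → (∀ i → lookup u i ≡ lookup v i) → u ≡ v
lookup-ext {u = u} {v} eq =
  trans (sym (Vec.tabulate∘lookup u)) (trans (Vec.tabulate-cong eq) (Vec.tabulate∘lookup v))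

lookup≤sum : ∀ {k} (a : Vec ℕ k) i → lookup a i ≤ Vec.sum a
lookup≤sum (x ∷ a) zero    = m≤m+n x _
lookup≤sum (x ∷ a) (suc i) = ≤-trans (lookup≤sum a i) (m≤n+m _ x)

module Coding {n : ℕ} (a : Vec ℕ n) where
  open Diagram a
  open Cells a refl

  anyBox? : {P : Box → Set} → Decidable P → Dec (∃ P)
  anyBox? P? = map′ (λ (i , c , p) → (i , c) , p) (λ ((i , c) , p) → i , c , p)
    (Fin.any? λ i → Fin.any? λ c → P? (i , c))

  module _ (F : Filling) where

    inColumn? : ∀ x c → Dec (∃ λ d → col d ≡ c × x ∈ₛ F d)
    inColumn? x c = anyBox? λ d → col d ≟ c ×-dec x Subset.∈? F d

    -- In each column an arbitrary box containing x is taken; under S1 there is no other, so none is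
    -- missed.
    cellsBelow : Fin n → ℕ → List Cell
    cellsBelow x zero    = []
    cellsBelow x (suc N) with inColumn? x N
    ... | yes (d , _) = cell d ∷ cellsBelow x N
    ... | no  _       = cellsBelow x N

    cellsBelow-< : ∀ x N → All (λ c → column c < N) (cellsBelow x N)
    cellsBelow-< x zero = []
    cellsBelow-< x (suc N) with inColumn? x N
    ... | yes (d , refl , _) = ≤-refl ∷ All.map m≤n⇒m≤1+n (cellsBelow-< x N)
    ... | no  _              = All.map m≤n⇒m≤1+n (cellsBelow-< x N)

    cellsBelow-descending : ∀ x N → AllPairs _⊳_ (cellsBelow x N)
    cellsBelow-descending x zero = []
    cellsBelow-descending x (suc N) with inColumn? x N
    ... | yes (d , refl , _) = cellsBelow-< x N ∷ cellsBelow-descending x N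
    ... | no  _              = cellsBelow-descending x N

    ∈-cellsBelow⁻ : ∀ x N {c} → c ∈ cellsBelow x N → ∃ λ d → cell d ≡ c × x ∈ₛ F d
    ∈-cellsBelow⁻ x (suc N) c∈ with inColumn? x N | c∈
    ... | yes (d , _ , x∈) | here refl = d , refl , x∈
    ... | yes _            | there c∈′ = ∈-cellsBelow⁻ x N c∈′
    ... | no  _            | c∈′       = ∈-cellsBelow⁻ x N c∈′

    ∈-cellsBelow⁺ : S1 F → ∀ x N {d} → col d < N → x ∈ₛ F d → cell d ∈ cellsBelow x N
    ∈-cellsBelow⁺ s1 x (suc N) {d} lt x∈ with inColumn? x N | m≤n⇒m<n∨m≡n (s≤s⁻¹ lt)
    ... | yes _  | inj₁ lt′ = there (∈-cellsBelow⁺ s1 x N lt′ x∈)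
    ... | no _   | inj₁ lt′ = ∈-cellsBelow⁺ s1 x N lt′ x∈
    ... | no ¬e  | inj₂ eq  = contradiction (d , eq , x∈) ¬e
    ... | yes (e , eqᵉ , x∈e) | inj₂ eq with d ≟ᵇ e
    ...   | yes refl = here refl
    ...   | no d≢e   = contradiction (x∈ , x∈e) (s1 d e (trans eq (sym eqᵉ)) d≢e x)

    code : Code n
    -- Columns are numbered from 0 and a row is no longer than the sum of all rows, so `Vec.sum a`
    -- exceeds every column number.
    code = Vec.tabulate λ x → cellsBelow x (Vec.sum a)

    lookup-code : ∀ x → lookup code x ≡ cellsBelow x (Vec.sum a)
    lookup-code = Vec.lookup∘tabulate _

    code-allPairs : ∀ x → AllPairs _⊳_ (lookup code x)
    code-allPairs x = subst (AllPairs _⊳_) (sym (lookup-code x)) (cellsBelow-descending x (Vec.sum a))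

    code-descending : ∀ x → Descending (lookup code x)
    code-descending x = AllPairs⇒Linked (code-allPairs x)

    code-boxed : ∀ {x c} → c ∈ lookup code x → ∃ λ d → cell d ≡ c × x ∈ₛ F d
    code-boxed {x} c∈ = ∈-cellsBelow⁻ x (Vec.sum a) (subst (_ ∈_) (lookup-code x) c∈)

    filling⇒code : S1 F → ∀ {x} d → x ∈ₛ F d → cell d ∈ lookup code x
    filling⇒code s1 {x} d x∈ = subst (_ ∈_) (sym (lookup-code x))
      (∈-cellsBelow⁺ s1 x (Vec.sum a) (<-≤-trans (Fin.toℕ<n (proj₂ d)) (lookup≤sum a (row d))) x∈)

    code⇒filling : ∀ {x} d → cell d ∈ lookup code x → x ∈ₛ F d
    code⇒filling d c∈ with e , eq , x∈ ← code-boxed c∈ with refl ← cell-injective eq = x∈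

  boxes-unique : Unique boxes
  boxes-unique = Unique-concatMap (λ i → map (i ,_) (allFin (lookup a i))) same
    (λ {i} _ → Unique.map⁺ (λ { refl → refl }) (Unique.allFin⁺ (lookup a i))) (Unique.allFin⁺ n)
    where
    same : ∀ {i j z} → z ∈ map (i ,_) (allFin (lookup a i)) → z ∈ map (j ,_) (allFin (lookup a j)) → i ≡ j
    same p q = trans (sym (∈-map-,⁻ p)) (∈-map-,⁻ q)

  ∈-boxes : ∀ d → d ∈ boxes
  ∈-boxes (i , c) = ∈-concatMap⁺ (λ i → map (i ,_) (allFin (lookup a i))) {xs = allFin n}
    (lose (∈-allFin i) (∈-map⁺ (i ,_) (∈-allFin c)))

  filling-ext : ∀ {T T′ : Table} → (∀ d → filling T d ≡ filling T′ d) → T ≡ T′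
  filling-ext eq = table-ext a λ i → lookup-ext λ c → eq (i , c)
    where
    table-ext : ∀ {m} (a : Vec ℕ m) {T T′ : VecAll.All (Vec (Subset n)) a} →
      (∀ i → lookup⁺ T i ≡ lookup⁺ T′ i) → T ≡ T′
    table-ext []      {[]}    {[]}     eq = refl
    table-ext (k ∷ a) {_ ∷ T} {_ ∷ T′} eq = cong₂ _∷_ (eq zero) (table-ext a (eq ∘ suc))

  tabulateFilling : Filling → Table
  tabulateFilling F = lookup⁻ λ i → Vec.tabulate λ c → F (i , c)

  filling-tabulate : ∀ F d → filling (tabulateFilling F) d ≡ F d
  filling-tabulate F (i , c) = trans (cong (λ v → lookup v c) (lookup⁺∘lookup⁻ a _ i)) (Vec.lookup∘tabulate _ c)
    where
    lookup⁺∘lookup⁻ : ∀ {A : ℕ → Set} {m} (a : Vec ℕ m) (f : ∀ i → A (lookup a i)) i →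
      lookup⁺ (lookup⁻ {P = A} {xs = a} f) i ≡ f i
    lookup⁺∘lookup⁻ (k ∷ a) f zero    = refl
    lookup⁺∘lookup⁻ (k ∷ a) f (suc i) = lookup⁺∘lookup⁻ a (f ∘ suc) i

  SSF-unique : Unique SSF
  SSF-unique = Unique.filter⁺ (λ T → semistandard? (filling T)) (tables-unique a)
    where
    tables-unique : ∀ {m} (a : Vec ℕ m) → Unique (tables (vectors (outside ∷ inside ∷ []) n) a)
    tables-unique []      = [] ∷ []
    tables-unique (k ∷ a) = Unique.cartesianProductWith⁺ _∷_ (λ { refl → refl , refl })
      (vectors-unique (vectors-unique (((λ ()) ∷ []) ∷ [] ∷ []) n) k) (tables-unique a)

  ∈-SSF⁺ : ∀ {T} → Semistandard (filling T) → T ∈ SSF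
  ∈-SSF⁺ {T} = ∈-filter⁺ (λ T → semistandard? (filling T)) (tables-complete a T)
    where
    bool : ∀ x → x ∈ outside ∷ inside ∷ []
    bool false = here refl
    bool true  = there (here refl)
    tables-complete : ∀ {m} (a : Vec ℕ m) T → T ∈ tables (vectors (outside ∷ inside ∷ []) n) a
    tables-complete []      []      = here refl
    tables-complete (k ∷ a) (v ∷ T) = ∈-cartesianProductWith⁺ _∷_
      (vectors-complete _ v λ i → vectors-complete _ (lookup v i) λ j → bool _) (tables-complete a T)

  ∈-SSF⁻ : ∀ {T} → T ∈ SSF → Semistandard (filling T)
  ∈-SSF⁻ T∈ = proj₂ (∈-filter⁻ (λ T → semistandard? (filling T))
    {xs = tables (vectors (outside ∷ inside ∷ []) n) a} T∈)

-- Weight and excess read off the word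

split-total : ∀ {p n} {b : WeakKomposition n} {w C} → Split p b w C →
  total (Vec.toList b) ≡ length w + excess (Vec.toList b)
split-total done    = refl
split-total (nil s) = split-total s
split-total (black {b = b} {w = w} {cs = cs} _ s) = cong suc (begin
  length cs + total (Vec.toList b)                     ≡⟨ cong (length cs +_) (split-total s) ⟩
  length cs + (length w + excess (Vec.toList b))       ≡⟨ +-assoc (length cs) _ _ ⟨
  length cs + length w + excess (Vec.toList b)         ≡⟨ cong (_+ excess (Vec.toList b)) (List.length-++ cs) ⟨
  length (cs ++ w) + excess (Vec.toList b)             ∎)
  where open ≡-Reasoning
split-total (red {b = b} {w = w} {cs = cs} s) = begin
  suc (length cs + total (Vec.toList b))               ≡⟨ cong (λ t → suc (length cs + t)) (split-total s) ⟩
  suc (length cs + (length w + excess (Vec.toList b))) ≡⟨ cong suc (+-assoc (length cs) _ _) ⟨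
  suc (length cs + length w + excess (Vec.toList b))   ≡⟨ +-suc _ _ ⟨
  length cs + length w + suc (excess (Vec.toList b))   ≡⟨ cong (_+ suc (excess (Vec.toList b))) (List.length-++ cs) ⟨
  length (cs ++ w) + suc (excess (Vec.toList b))       ∎
  where open ≡-Reasoning

split-value : ∀ {p n} {b : WeakKomposition n} {w C} → Split p b w C →
  ∀ x → value (lookup b x) ≡ length (lookup C x)
split-value (nil s)     zero    = refl
split-value (black _ s) zero    = refl
split-value (red s)     zero    = refl
split-value (nil s)     (suc x) = split-value s x
split-value (black _ s) (suc x) = split-value s x
split-value (red s)     (suc x) = split-value s x

at⇒∈ : ∀ {p} w k {c} → At p w (suc k) c → c ∈ w
at⇒∈ (d ∷ w) zero    refl = here refl
at⇒∈ (d ∷ w) (suc k) h    = there (at⇒∈ w k h)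

∈⇒at : ∀ {p} w {c} → c ∈ w → ∃ λ k → At p w (suc k) c
∈⇒at (d ∷ w) (here refl) = 0 , refl
∈⇒at (d ∷ w) (there c∈)  = let k , h = ∈⇒at w c∈ in suc k , h

-- The constant part of the excess: occurrences of boxes in w beyond the first. Red pieces account
-- for the remaining free entries.
weight : List Cell → ℕ
weight w = length w ∸ length (deduplicate _≟ᶜᵉ_ w)

length-concatMap-total : ∀ {A X : Set} {n} (b : WeakKomposition n) (f : Fin n → X) (g : X → List A) →
  (∀ i → value (lookup b i) ≡ length (g (f i))) →
  length (concatMap g (List.tabulate f)) ≡ total (Vec.toList b)
length-concatMap-total []      f g eq = refl
length-concatMap-total (x ∷ b) f g eq = trans (List.length-++ (g (f zero)))
  (cong₂ _+_ (sym (eq zero)) (length-concatMap-total b (f ∘ suc) g (eq ∘ suc)))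

module Sizes {n : ℕ} (a : Vec ℕ n) (F : Diagram.Filling a) (ss : Diagram.Semistandard a F)
  {b : WeakKomposition n} {w : List Cell} (s : Split nothing b w (Coding.code a F)) where

  open Diagram a
  open Semistandard ss
  open Cells a refl
  open Coding a

  C : Code n
  C = code F

  open Entries s (code-descending F)

  code-unique : ∀ x → Unique (lookup C x)
  code-unique x = AllPairs.map (λ gt eq → ⊳⇒≢ gt (cong just eq)) (code-allPairs F x)

  wt-≡ : wt F ≡ Vec.map value b
  wt-≡ = lookup-ext λ x → begin
    lookup (wt F) x
      ≡⟨ Vec.lookup∘tabulate _ x ⟩
    length (filter (λ d → x Subset.∈? F d) boxes)
      ≡⟨ List.length-map cell (filter (λ d → x Subset.∈? F d) boxes) ⟨
    length (map cell (filter (λ d → x Subset.∈? F d) boxes))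
      ≡⟨ Perm.↭-length (cells-↭ x) ⟩
    length (lookup C x)
      ≡⟨ split-value s x ⟨
    value (lookup b x)
      ≡⟨ Vec.lookup-map x value b ⟨
    lookup (Vec.map value b) x ∎
    where
    open ≡-Reasoning
    cells-↭ : ∀ x → map cell (filter (λ d → x Subset.∈? F d) boxes) ↭ lookup C x
    cells-↭ x = sameMembers⇒↭
      (Unique.map⁺ cell-injective (Unique.filter⁺ (λ d → x Subset.∈? F d) boxes-unique)) (code-unique x) sub sup
      where
      sub : ∀ {c} → c ∈ map cell (filter (λ d → x Subset.∈? F d) boxes) → c ∈ lookup C x
      sub c∈ with d , d∈ , refl ← ∈-map⁻ cell c∈ =
        filling⇒code F s1 d (proj₂ (∈-filter⁻ (λ d → x Subset.∈? F d) {xs = boxes} d∈))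
      sup : ∀ {c} → c ∈ lookup C x → c ∈ map cell (filter (λ d → x Subset.∈? F d) boxes)
      sup c∈ with d , refl , x∈ ← code-boxed F c∈ =
        ∈-map⁺ cell (∈-filter⁺ (λ d → x Subset.∈? F d) (∈-boxes d) x∈)

  boxes-length : length boxes ≡ length (deduplicate _≟ᶜᵉ_ w)
  boxes-length = trans (sym (List.length-map cell boxes)) (Perm.↭-length (sameMembers⇒↭
    (Unique.map⁺ cell-injective boxes-unique) (Unique.deduplicate-! _≟ᶜᵉ_ w) sub sup))
    where
    sub : ∀ {c} → c ∈ map cell boxes → c ∈ deduplicate _≟ᶜᵉ_ w
    sub c∈ with d , _ , refl ← ∈-map⁻ cell c∈
      with x , x∈ ← nonempty d
      with entry⇒pos (filling⇒code F s1 d x∈)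
    ... | suc k , _ , h = ∈-deduplicate⁺ _≟ᶜᵉ_ (at⇒∈ w k h)
    sup : ∀ {c} → c ∈ deduplicate _≟ᶜᵉ_ w → c ∈ map cell boxes
    sup {c} c∈ with k , h ← ∈⇒at {nothing} w (∈-deduplicate⁻ _≟ᶜᵉ_ w c∈)
      with x , p ← at⇒pos {c} {suc k} h
      with d , refl , _ ← code-boxed F (pos⇒entry p) = ∈-map⁺ cell (∈-boxes d)

  anchor : ∀ d → ∃ λ x → Anchor F d x
  anchor d = maximum (Subset._∈? F d) (nonempty d)

  frees anchors : List (Box × Fin n)
  frees   = filter (λ (d , x) → free? F d x) (cartesianProduct boxes (allFin n))
  anchors = map (λ d → d , proj₁ (anchor d)) boxes

  code-entries : List (Cell × Fin n)
  code-entries = concatMap (λ x → map (_, x) (lookup C x)) (allFin n)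

  -- A double count of all entries: box by box, as the free ones and one anchor each, and value by
  -- value, along the pieces of the code.
  entries-↭ : map (λ (d , x) → cell d , x) (frees ++ anchors) ↭ code-entries
  entries-↭ = sameMembers⇒↭
    (Unique.map⁺ (λ eq → cong₂ _,_ (cell-injective (cong proj₁ eq)) (cong proj₂ eq))
      (Unique.++⁺ (Unique.filter⁺ (λ (d , x) → free? F d x)
          (Unique.cartesianProduct⁺ boxes-unique (Unique.allFin⁺ n)))
        (Unique.map⁺ (cong proj₁) boxes-unique) disjoint))
    (Unique-concatMap (λ x → map (_, x) (lookup C x)) same
      (λ {x} _ → Unique.map⁺ (cong proj₁) (code-unique x)) (Unique.allFin⁺ n))
    sub sup
    where
    frees⁻ : ∀ {d x} → (d , x) ∈ frees → Free F d x
    frees⁻ p = proj₂ (∈-filter⁻ (λ (d , x) → free? F d x) {xs = cartesianProduct boxes (allFin n)} p)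
    disjoint : ∀ {z} → ¬ (z ∈ frees × z ∈ anchors)
    disjoint (p , q) with d , _ , refl ← ∈-map⁻ (λ d → d , proj₁ (anchor d)) q =
      proj₂ (frees⁻ p) (proj₂ (anchor d))
    same : ∀ {x y z} → z ∈ map (_, x) (lookup C x) → z ∈ map (_, y) (lookup C y) → x ≡ y
    same p q with _ , _ , refl ← ∈-map⁻ (_, _) p with _ , _ , refl ← ∈-map⁻ (_, _) q = refl
    entry : ∀ {d x} → x ∈ₛ F d → (cell d , x) ∈ code-entries
    entry {d} {x} x∈ = ∈-concatMap⁺ (λ x → map (_, x) (lookup C x)) {xs = allFin n}
      (lose (∈-allFin x) (∈-map⁺ (_, x) (filling⇒code F s1 d x∈)))
    sub : ∀ {z} → z ∈ map (λ (d , x) → cell d , x) (frees ++ anchors) → z ∈ code-entries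
    sub z∈ with (d , x) , p , refl ← ∈-map⁻ (λ (d , x) → cell d , x) z∈ with ∈-++⁻ frees p
    ... | inj₁ q = entry {d} (proj₁ (frees⁻ q))
    ... | inj₂ q with _ , _ , refl ← ∈-map⁻ (λ d → d , proj₁ (anchor d)) q = entry {d} (proj₁ (proj₂ (anchor d)))
    sup : ∀ {z} → z ∈ code-entries → z ∈ map (λ (d , x) → cell d , x) (frees ++ anchors)
    sup z∈ with x , _ , q ← find (∈-concatMap⁻ (λ x → map (_, x) (lookup C x)) {xs = allFin n} z∈)
      with c , c∈ , refl ← ∈-map⁻ (_, x) q
      with d , refl , x∈ ← code-boxed F c∈ = ∈-map⁺ (λ (d , x) → cell d , x) (member (anchor? F d x))
      where
      member : Dec (Anchor F d x) → (d , x) ∈ frees ++ anchors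
      member (no ¬x!) = ∈-++⁺ˡ (∈-filter⁺ (λ (d , x) → free? F d x)
        (∈-cartesianProduct⁺ (∈-boxes d) (∈-allFin x)) (x∈ , ¬x!))
      member (yes x!) = ∈-++⁺ʳ frees (subst (λ y → (d , y) ∈ anchors)
        (Fin.≤-antisym (proj₂ x! _ (proj₁ (proj₂ (anchor d)))) (proj₂ (proj₂ (anchor d)) x x∈))
        (∈-map⁺ (λ d → d , proj₁ (anchor d)) (∈-boxes d)))

  ex-≡ : ex F ≡ weight w + excess (Vec.toList b)
  ex-≡ = begin
    ex F                       ≡⟨ m+n∸n≡m (ex F) D ⟨
    ex F + D ∸ D               ≡⟨ cong (_∸ D) sum-≡ ⟩
    length w + e ∸ D           ≡⟨ +-∸-comm e (List.length-deduplicate _≟ᶜᵉ_ w) ⟩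
    length w ∸ D + e           ∎
    where
    open ≡-Reasoning
    D = length (deduplicate _≟ᶜᵉ_ w)
    e = excess (Vec.toList b)
    value-length : ∀ x → value (lookup b x) ≡ length (map (_, x) (lookup C x))
    value-length x = trans (split-value s x) (sym (List.length-map (_, x) (lookup C x)))
    sum-≡ : ex F + D ≡ length w + e
    sum-≡ = begin
      ex F + D                                                    ≡⟨ cong (ex F +_) boxes-length ⟨
      ex F + length boxes                                         ≡⟨ cong (ex F +_) (List.length-map _ boxes) ⟨
      length frees + length anchors                               ≡⟨ List.length-++ frees ⟨
      length (frees ++ anchors)                                   ≡⟨ List.length-map _ (frees ++ anchors) ⟨
      length (map (λ (d , x) → cell d , x) (frees ++ anchors))    ≡⟨ Perm.↭-length entries-↭ ⟩
      length code-entries                                         ≡⟨ length-concatMap-total b id (λ x → map (_, x) (lookup C x)) value-length ⟩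
      total (Vec.toList b)                                        ≡⟨ split-total s ⟩
      length w + e                                                ∎

-- Collecting the expansion

-- The objects xs are in bijection with the pairs of a word w occurring among
-- them and a glide of runs w.
module Expansion {n : ℕ} {X W : Set} (_≟ʷ_ : DecidableEquality W)
  (runs : W → List ℕ) (runs-positive : ∀ w → IsComposition (runs w)) (weight : W → ℕ)
  (degree : X → ℕ) (monomial : X → Vec ℕ n) (word : X → W) (komp : X → WeakKomposition n)
  (xs : List X) (xs-unique : Unique xs)
  (degree-≡ : ∀ {x} → x ∈ xs → degree x ≡ weight (word x) + excess (Vec.toList (komp x)))
  (monomial-≡ : ∀ {x} → x ∈ xs → monomial x ≡ Vec.map value (komp x))
  (injective : ∀ {x y} → x ∈ xs → y ∈ xs → word x ≡ word y → komp x ≡ komp y → x ≡ y)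
  (parse : ∀ {x} → x ∈ xs → Parse nothing (runs (word x)) (Vec.toList (komp x)))
  (realise : ∀ {x} → x ∈ xs → ∀ b → Parse nothing (runs (word x)) (Vec.toList b) →
    ∃ λ y → y ∈ xs × word y ≡ word x × komp y ≡ b)
  where

  poly : Poly n
  poly = map (λ x → term 1ℤ (degree x) (monomial x)) xs

  words : List W
  words = deduplicate _≟ʷ_ (map word xs)

  pairs : List (W × WeakKomposition n)
  pairs = concatMap (λ w → map (w ,_) (glidesOf n (runs w))) words

  pairTerm : W × WeakKomposition n → Term n
  pairTerm (w , b) = term 1ℤ (weight w + excess (Vec.toList b)) (Vec.map value b)

  encode : X → W × WeakKomposition n
  encode x = word x , komp x

  -- Surjectivity is `realise`: a word that occurs at all occurs with every glide of its run
  -- composition.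
  encode-↭ : map encode xs ↭ pairs
  encode-↭ = sameMembers⇒↭
    (Unique-map encode (λ p q eq → injective p q (cong proj₁ eq) (cong proj₂ eq)) xs-unique)
    (Unique-concatMap _ same (λ {w} _ → Unique.map⁺ (cong proj₂) (glidesOf-unique n (runs w)))
      (Unique.deduplicate-! _≟ʷ_ (map word xs)))
    sub sup
    where
    same : ∀ {w w′ z} → z ∈ map (w ,_) (glidesOf n (runs w)) → z ∈ map (w′ ,_) (glidesOf n (runs w′)) → w ≡ w′
    same p q = trans (sym (∈-map-,⁻ p)) (∈-map-,⁻ q)
    sub : ∀ {z} → z ∈ map encode xs → z ∈ pairs
    sub p with x , x∈ , refl ← ∈-map⁻ encode p =
      ∈-concatMap⁺ _ (lose (∈-deduplicate⁺ _≟ʷ_ (∈-map⁺ word x∈))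
        (∈-map⁺ (word x ,_) (∈-glidesOf⁺ (runs-positive (word x)) (parse x∈))))
    sup : ∀ {z} → z ∈ pairs → z ∈ map encode xs
    sup p with w , w∈ , q ← find (∈-concatMap⁻ (λ w → map (w ,_) (glidesOf n (runs w))) {xs = words} p)
      with b , b∈ , refl ← ∈-map⁻ (w ,_) q
      with x , x∈ , refl ← ∈-map⁻ word (∈-deduplicate⁻ _≟ʷ_ (map word xs) w∈)
      with y , y∈ , eqʷ , refl ← realise x∈ b (∈-glidesOf⁻ (runs-positive (word x)) b∈) =
      subst (λ w → (w , b) ∈ map encode xs) eqʷ (∈-map⁺ encode y∈)

  expansion : Poly n
  expansion = sumOver words λ w → βshift (weight w) (multifundamental n (runs w))

  poly≈expansion : poly ≈ expansion
  poly≈expansion k e = begin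
    coeff poly k e
      ≡⟨ cong (λ p → coeff p k e) (trans
           (map-cong-∈ xs λ x∈ → cong₂ (term 1ℤ) (degree-≡ x∈) (monomial-≡ x∈)) (List.map-∘ xs)) ⟩
    coeff (map pairTerm (map encode xs)) k e
      ≡⟨ coeff-↭ (Perm.map⁺ pairTerm encode-↭) k e ⟩
    coeff (map pairTerm pairs) k e
      ≡⟨ cong (λ p → coeff p k e) (trans (List.map-concatMap pairTerm _ words) (List.concatMap-cong glides words)) ⟩
    coeff expansion k e ∎
    where
    open ≡-Reasoning
    map-cong-∈ : ∀ {f g : X → Term n} xs → (∀ {x} → x ∈ xs → f x ≡ g x) → map f xs ≡ map g xs
    map-cong-∈ []       eq = refl
    map-cong-∈ (x ∷ xs) eq = cong₂ _∷_ (eq (here refl)) (map-cong-∈ xs (eq ∘ there))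
    glides : ∀ w → map pairTerm (map (w ,_) (glidesOf n (runs w))) ≡
      βshift (weight w) (multifundamental n (runs w))
    glides w = trans (sym (List.map-∘ (glidesOf n (runs w))))
      (sym (βshift-multifundamental (weight w) (runs w)))

  quasisymmetric : IsQuasisymmetric poly
  quasisymmetric k a a′ eq = begin
    coeff poly k a        ≡⟨ poly≈expansion k a ⟩
    coeff expansion k a   ≡⟨ sumOver-cong words k a a′ (λ {w} _ →
                               multifundamental-quasisymmetric (runs-positive w) (weight w) k a a′ eq) ⟩
    coeff expansion k a′  ≡⟨ poly≈expansion k a′ ⟨
    coeff poly k a′       ∎
    where open ≡-Reasoning

  weightedRuns : List (ℕ × List ℕ)
  weightedRuns = map (λ w → weight w , runs w) words

  supp : List (List ℕ)
  supp = deduplicate _≟ᶜ_ (map proj₂ weightedRuns)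

  supp-compositions : All IsComposition supp
  supp-compositions = All.tabulate λ γ∈ → composition (∈-deduplicate⁻ _≟ᶜ_ (map proj₂ weightedRuns) γ∈)
    where
    composition : ∀ {γ} → γ ∈ map proj₂ weightedRuns → IsComposition γ
    composition p with _ , q , refl ← ∈-map⁻ proj₂ p with w , _ , refl ← ∈-map⁻ (λ w → weight w , runs w) q =
      runs-positive w

  positive-expansion : Σ (List ℕ → ℕ[β]) λ J → Σ (List (List ℕ)) λ supp →
      Unique supp × All IsComposition supp ×
      (∀ γ → γ ∉ supp → J γ ≡ []) ×
      poly ≈ sumOver supp (λ γ → J γ · multifundamental n γ)
  positive-expansion =
    multiplicity weightedRuns , supp , supp-unique , supp-compositions ,
    (λ γ γ∉ → multiplicity-∉ weightedRuns (γ∉ ∘ ∈-deduplicate⁺ _≟ᶜ_)) ,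
    λ k e → trans (poly≈expansion k e) (trans
      (cong (λ p → coeff p k e) (sym (List.concatMap-map _ _ words)))
      (sym (weighted-≈ (multifundamental n) weightedRuns supp-unique (∈-deduplicate⁺ _≟ᶜ_) k e)))
    where
    supp-unique = Unique.deduplicate-! _≟ᶜ_ (map proj₂ weightedRuns)

-- Fillings from codes

-- The choice is extended by 0 beyond ℓ, so that ρ is a total function on ℕ that `place` can shift
-- freely.
choose : ∀ {n} ℓ {P : ℕ → Fin n → Set} → (∀ r → r < ℓ → ∃ (P r)) →
  ∃ λ (ρ : ℕ → ℕ) → ∀ r → r < ℓ → ∃ λ x → ρ r ≡ toℕ x × P r x
choose {n} ℓ {P} h = (λ r → pick r (r <? ℓ)) , λ r lt → picked r lt (r <? ℓ)
  where
  pick : ∀ r → Dec (r < ℓ) → ℕ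
  pick r (yes lt) = toℕ (proj₁ (h r lt))
  pick r (no _)   = 0
  picked : ∀ r → r < ℓ → (d : Dec (r < ℓ)) → ∃ λ x → pick r d ≡ toℕ x × P r x
  picked r lt (yes lt′) = let x , px = h r lt′ in x , refl , px
  picked r lt (no ¬lt)  = contradiction lt ¬lt

rank-< : ∀ {n} (a : Vec ℕ n) i → 0 < lookup a i → rank a i < length (positivePart a)
rank-< (suc x ∷ a) zero    _   = s≤s z≤n
rank-< (zero ∷ a)  (suc i) pos = rank-< a i pos
rank-< (suc x ∷ a) (suc i) pos = s≤s (rank-< a i pos)

pred-< : ∀ {m k} → 0 < m → m < suc k → pred m < k
pred-< {suc m} _ (s≤s lt) = lt

-- Rows are filled from the bottom: the lowest one receives the first part exactly if ρ 0 = 0, and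
-- either way the remaining parts are placed one row lower in the recursion. Their positions are
-- positive by monotonicity, so `pred` does not truncate there.
place : ∀ n (ρ : ℕ → ℕ) {α} → IsComposition α → (∀ r → r < length α → ρ r < n) →
  (∀ r t → r < t → t < length α → ρ r < ρ t) →
  Σ (Vec ℕ n) λ a → positivePart a ≡ α × (∀ i → 0 < lookup a i → ρ (rank a i) ≡ toℕ i)
place zero    ρ []        bounded mono = [] , refl , λ ()
place zero    ρ (_ ∷ _)   bounded mono with () ← bounded 0 (s≤s z≤n)
place (suc n) ρ []        bounded mono =
  let a , a⁺ , h = place n ρ [] (λ _ ()) (λ _ _ _ ()) in
  0 ∷ a , a⁺ , λ { (suc i) pos → contradiction (rank-< a i pos)
    (subst (λ γ → ¬ rank a i < length γ) (sym a⁺) λ ()) }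
place (suc n) ρ {suc x ∷ α} (_ ∷ pos) bounded mono with ρ 0 in eq
... | zero =
  let a , a⁺ , h = place n (pred ∘ ρ ∘ suc) pos
        (λ r lt → pred-< (later r lt) (bounded (suc r) (s≤s lt)))
        (λ r t r<t lt → pred-< (later r (<-trans r<t lt))
          (subst (ρ (suc r) <_) (sym (suc-pred (ρ (suc t)) {{>-nonZero (later t lt)}}))
            (mono (suc r) (suc t) (s≤s r<t) (s≤s lt))))
  in suc x ∷ a , cong (suc x ∷_) a⁺ , λ
    { zero _ → eq
    ; (suc i) pos → trans
        (sym (suc-pred (ρ (suc (rank a i))) {{>-nonZero
          (later (rank a i) (subst (λ γ → rank a i < length γ) a⁺ (rank-< a i pos)))}}))
        (cong suc (h i pos)) }
  where
  later : ∀ r → r < length α → 0 < ρ (suc r)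
  later r lt = subst (_< ρ (suc r)) eq (mono 0 (suc r) (s≤s z≤n) (s≤s lt))
... | suc _ =
  let a , a⁺ , h = place n (pred ∘ ρ) {suc x ∷ α} (s≤s z≤n ∷ pos)
        (λ r lt → pred-< (all r lt) (bounded r lt))
        (λ r t r<t lt → pred-< (all r (<-trans r<t lt))
          (subst (ρ r <_) (sym (suc-pred (ρ t) {{>-nonZero (all t lt)}})) (mono r t r<t lt)))
  in 0 ∷ a , a⁺ , λ { (suc i) pos → trans
        (sym (suc-pred (ρ (rank a i)) {{>-nonZero
          (all (rank a i) (subst (λ γ → rank a i < length γ) a⁺ (rank-< a i pos)))}}))
        (cong suc (h i pos)) }
  where
  all : ∀ r → r < length (suc x ∷ α) → 0 < ρ r
  all zero    _  = subst (0 <_) (sym eq) (s≤s z≤n)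
  all (suc r) lt = ≤-trans (s≤s z≤n) (mono 0 (suc r) (s≤s z≤n) lt)

nth-< : ∀ α r → 0 < nth α r → r < length α
nth-< (x ∷ α) zero    _   = s≤s z≤n
nth-< (x ∷ α) (suc r) pos = s≤s (nth-< α r pos)

nth-positive : ∀ {α} → IsComposition α → ∀ r → r < length α → 0 < nth α r
nth-positive (pos ∷ _) zero    _        = pos
nth-positive (_ ∷ pos) (suc r) (s≤s lt) = nth-positive pos r lt

module Realise {n : ℕ} {α : List ℕ} (α-positive : IsComposition α)
  {b : WeakKomposition n} {w : List Cell} (g : Good α w) {C : Code n}
  (s : Split nothing b w C) (desc : ∀ v → Descending (lookup C v)) where

  open Good g
  open Entries s desc

  top-unique : ∀ {x y c} → Top x c → Top y c → x ≡ y
  top-unique {x} {y} (x∈ , max) (y∈ , max′) = Fin.≤-antisym (max′ x x∈) (max y y∈)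

  row-tops : ∃ λ (ρ : ℕ → ℕ) → ∀ r → r < length α → ∃ λ x → ρ r ≡ toℕ x × Top x (r , 0)
  row-tops = choose (length α) λ r lt →
    let k , h = complete {r , 0} (nth-positive α-positive r lt)
        x , p = at⇒pos {r , 0} {k} h
    in top-exists (pos⇒entry p)

  -- S5 dictates the row of each part of α.
  placement : Σ (Vec ℕ n) λ a → positivePart a ≡ α × (∀ i → 0 < lookup a i → Top i (rank a i , 0))
  placement =
    let a , a⁺≡α , ρ-rank = place n ρ α-positive bounded mono in
    a , a⁺≡α , λ i pos →
      let x , eq , x! = tops (rank a i) (subst (λ γ → rank a i < length γ) a⁺≡α (rank-< a i pos))
      in subst (λ y → Top y (rank a i , 0)) (Fin.toℕ-injective (trans (sym eq) (ρ-rank i pos))) x!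
    where
    ρ = proj₁ row-tops
    tops = proj₂ row-tops
    bounded : ∀ r → r < length α → ρ r < n
    bounded r lt = let x , eq , _ = tops r lt in subst (_< n) (sym eq) (Fin.toℕ<n x)
    -- `columns` orders the positions of the two anchors, and since both are in column 0 the order
    -- of their values is strict.
    mono : ∀ r t → r < t → t < length α → ρ r < ρ t
    mono r t r<t lt =
      let x , eq , x!  = tops r (<-trans r<t lt)
          y , eq′ , y! = tops t lt
          k , p = entry⇒pos (proj₁ x!)
          l , q = entry⇒pos (proj₁ y!)
      in subst₂ _<_ (sym eq) (sym eq′)
           (pos-< p q (columns r<t (top⇒last x! p) (top⇒last y! q)) (<-irrefl refl))

  module _ (a : Vec ℕ n) (a⁺≡α : positivePart a ≡ α) (tops : ∀ i → 0 < lookup a i → Top i (rank a i , 0)) where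

    open Diagram a
    open Cells a a⁺≡α
    open Coding a

    decoded : Filling
    decoded d = Vec.tabulate λ x → does (entry∈? (cell d) x)

    ∈-decoded⁺ : ∀ {x} d → cell d ∈ lookup C x → x ∈ₛ decoded d
    ∈-decoded⁺ {x} d c∈ = Vec.lookup⇒[]= x (decoded d)
      (trans (Vec.lookup∘tabulate _ x) (dec-true (entry∈? (cell d) x) c∈))

    ∈-decoded⁻ : ∀ {x} d → x ∈ₛ decoded d → cell d ∈ lookup C x
    ∈-decoded⁻ {x} d x∈ = from (entry∈? (cell d) x)
      (trans (sym (Vec.lookup∘tabulate (λ x → does (entry∈? (cell d) x)) x)) (Vec.[]=⇒lookup x∈))
      where
      from : ∀ {P : Set} (P? : Dec P) → does P? ≡ true → P
      from (yes p) _ = p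

    -- The filling of `decodedTable` agrees with `decoded` only pointwise, so the argument is made
    -- for every such F.
    module _ (F : Filling) (F≡ : ∀ d → F d ≡ decoded d) where

      F⇒C : ∀ {x} d → x ∈ₛ F d → cell d ∈ lookup C x
      F⇒C {x} d x∈ = ∈-decoded⁻ d (subst (x ∈ₛ_) (F≡ d) x∈)

      C⇒F : ∀ {x} d → cell d ∈ lookup C x → x ∈ₛ F d
      C⇒F {x} d c∈ = subst (x ∈ₛ_) (sym (F≡ d)) (∈-decoded⁺ d c∈)

      open Transfer a a⁺≡α s desc F F⇒C C⇒F

      decoded-s5 : S5 F
      decoded-s5 d c≡0 x x! = top-unique
        (subst (λ c → Top x (rank a (row d) , c)) c≡0 (anchor⇒top x!)) (tops (row d) (row-positive d))

      decoded-semistandard : Semistandard F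
      decoded-semistandard = semistandard g decoded-s5

      code-decoded : code F ≡ C
      code-decoded = lookup-ext λ x → sorted-≡ (λ p q → <-asym p q)
        (code-allPairs F x) (descending⇒allPairs (desc x)) sub sup
        where
        sub : ∀ {x c} → c ∈ lookup (code F) x → c ∈ lookup C x
        sub {x} c∈ = let d , eq , x∈ = code-boxed F c∈ in subst (_∈ lookup C x) eq (F⇒C d x∈)
        sup : ∀ {x c} → c ∈ lookup C x → c ∈ lookup (code F) x
        sup {x} c∈ =
          let k , p  = entry⇒pos c∈
              d , eq = box (shape {k} (proj₂ p))
          in subst (_∈ lookup (code F) x) eq
               (filling⇒code F (Semistandard.s1 decoded-semistandard) d (C⇒F d (subst (_∈ lookup C x) (sym eq) c∈)))

    decodedTable : Table
    decodedTable = tabulateFilling decoded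

    realised : Semistandard (filling decodedTable) × code (filling decodedTable) ≡ C
    realised = decoded-semistandard (filling decodedTable) (filling-tabulate decoded) ,
      code-decoded (filling decodedTable) (filling-tabulate decoded)

  realisation : Σ (Vec ℕ n) λ a → positivePart a ≡ α × Σ (Diagram.Table a) λ T →
    Diagram.Semistandard a (Diagram.filling a T) × Coding.code a (Diagram.filling a T) ≡ C
  realisation = let a , a⁺≡α , tops = placement in
    a , a⁺≡α , decodedTable a a⁺≡α tops , realised a a⁺≡α tops

-- A code determines the shape and the filling

module _ {n : ℕ} where

  -- By S5 the anchor of the first box of row i is i. The code keeps the cell and the entries of
  -- this box, so the matching row of a′ has the same height, and the rank in the cell fixes its
  -- length as a part of the common composition.
  code-determines-row : {a a′ : Vec ℕ n} (a⁺≡ : positivePart a ≡ positivePart a′)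
    {F : Diagram.Filling a} {F′ : Diagram.Filling a′} → Diagram.Semistandard a F → Diagram.Semistandard a′ F′ →
    Coding.code a F ≡ Coding.code a′ F′ → ∀ i → 0 < lookup a i → lookup a′ i ≡ lookup a i
  code-determines-row {a} {a′} a⁺≡ {F} {F′} ss ss′ C≡ i pos = begin
    lookup a′ i                         ≡⟨ cong (lookup a′) i′≡i ⟨
    lookup a′ (proj₁ d′)                ≡⟨ Cells.row-length a′ refl d′ ⟨
    nth (positivePart a′) (rank a′ (proj₁ d′)) ≡⟨ cong₂ nth (sym a⁺≡) (cong proj₁ eq) ⟩
    nth (positivePart a) (rank a i)     ≡⟨ nth-rank a i pos ⟩
    lookup a i                          ∎
    where
    open ≡-Reasoning
    d : Diagram.Box a
    d = i , fromℕ< pos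
    anchored : ∃ λ x → Diagram.Anchor a F d x
    anchored = maximum (Subset._∈? F d) (Diagram.Semistandard.nonempty ss d)
    x : Fin n
    x = proj₁ anchored
    x≡i : x ≡ i
    x≡i = Diagram.Semistandard.s5 ss d (Fin.toℕ-fromℕ< pos) x (proj₂ anchored)
    boxed : ∃ λ d′ → Cells.cell a′ refl d′ ≡ Cells.cell a refl d
    boxed = Cells.box a′ refl (subst (λ γ → Shape γ (Cells.cell a refl d)) a⁺≡ (Cells.cell-shape a refl d))
    d′ : Diagram.Box a′
    d′ = proj₁ boxed
    eq : Cells.cell a′ refl d′ ≡ Cells.cell a refl d
    eq = proj₂ boxed
    F⇒F′ : ∀ {y} → y ∈ₛ F d → y ∈ₛ F′ d′
    F⇒F′ {y} y∈ = Coding.code⇒filling a′ F′ d′ (subst₂ (λ c C → c ∈ lookup C y) (sym eq) C≡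
      (Coding.filling⇒code a F (Diagram.Semistandard.s1 ss) d y∈))
    F′⇒F : ∀ {y} → y ∈ₛ F′ d′ → y ∈ₛ F d
    F′⇒F {y} y∈ = Coding.code⇒filling a F d (subst₂ (λ c C → c ∈ lookup C y) eq (sym C≡)
      (Coding.filling⇒code a′ F′ (Diagram.Semistandard.s1 ss′) d′ y∈))
    i′≡i : proj₁ d′ ≡ i
    i′≡i = trans (sym (Diagram.Semistandard.s5 ss′ d′ (trans (cong proj₂ eq) (Fin.toℕ-fromℕ< pos)) x
      (F⇒F′ (proj₁ (proj₂ anchored)) , λ y y∈ → proj₂ (proj₂ anchored) y (F′⇒F y∈)))) x≡i

  code-determines-shape : {a a′ : Vec ℕ n} (a⁺≡ : positivePart a ≡ positivePart a′)
    {F : Diagram.Filling a} {F′ : Diagram.Filling a′} → Diagram.Semistandard a F → Diagram.Semistandard a′ F′ →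
    Coding.code a F ≡ Coding.code a′ F′ → a ≡ a′
  code-determines-shape {a} {a′} a⁺≡ ss ss′ C≡ = lookup-ext same
    where
    same : ∀ i → lookup a i ≡ lookup a′ i
    same i with 0 <? lookup a i | 0 <? lookup a′ i
    ... | yes pos | _       = sym (code-determines-row a⁺≡ ss ss′ C≡ i pos)
    ... | no _    | yes pos = code-determines-row (sym a⁺≡) ss′ ss (sym C≡) i pos
    ... | no ¬p   | no ¬p′  = trans (n≤0⇒n≡0 (≮⇒≥ ¬p)) (sym (n≤0⇒n≡0 (≮⇒≥ ¬p′)))

  code-determines-table : {a : Vec ℕ n} {T T′ : Diagram.Table a} →
    Diagram.S1 a (Diagram.filling a T) → Diagram.S1 a (Diagram.filling a T′) →
    Coding.code a (Diagram.filling a T) ≡ Coding.code a (Diagram.filling a T′) → T ≡ T′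
  code-determines-table {a} {T} {T′} s1 s1′ C≡ = Coding.filling-ext a λ d → Subset.⊆-antisym
    (λ {x} x∈ → Coding.code⇒filling a (filling T′) d
      (subst (λ C → _ ∈ lookup C x) C≡ (Coding.filling⇒code a (filling T) s1 d x∈)))
    (λ {x} x∈ → Coding.code⇒filling a (filling T) d
      (subst (λ C → _ ∈ lookup C x) (sym C≡) (Coding.filling⇒code a (filling T′) s1′ d x∈)))
    where open Diagram a

-- The tableaux of all shapes with positive part α

module Main (n : ℕ) {α : List ℕ} (α-positive : IsComposition α) where

  Tableau : Set
  Tableau = Σ (Vec ℕ n) Diagram.Table

  tableaux : List Tableau
  tableaux = concatMap (λ a → map (a ,_) (Diagram.SSF a)) (weakCompositions n α)

  degree : Tableau → ℕ
  degree (a , T) = Diagram.ex a (Diagram.filling a T)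

  monomial : Tableau → Vec ℕ n
  monomial (a , T) = Diagram.wt a (Diagram.filling a T)

  code : Tableau → Code n
  code (a , T) = Coding.code a (Diagram.filling a T)

  word : Tableau → List Cell
  word = wordFrom nothing ∘ code

  komp : Tableau → WeakKomposition n
  komp = kompFrom nothing ∘ code

  ∈-tableaux⁻ : ∀ {t} → t ∈ tableaux →
    positivePart (proj₁ t) ≡ α × Diagram.Semistandard (proj₁ t) (Diagram.filling (proj₁ t) (proj₂ t))
  ∈-tableaux⁻ t∈ =
    let a , a∈ , p = find (∈-concatMap⁻ (λ a → map (a ,_) (Diagram.SSF a)) {xs = weakCompositions n α} t∈) in
    from a∈ (∈-map⁻ (a ,_) p)
    where
    from : ∀ {a t} → a ∈ weakCompositions n α → (∃ λ T → T ∈ Diagram.SSF a × t ≡ (a , T)) →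
      positivePart (proj₁ t) ≡ α × Diagram.Semistandard (proj₁ t) (Diagram.filling (proj₁ t) (proj₂ t))
    from {a} a∈ (T , T∈ , refl) =
      proj₂ (∈-filter⁻ (λ a → List.≡-dec _≟_ (positivePart a) α) {xs = vectors (upTo (suc (sum α))) n} a∈) ,
      Coding.∈-SSF⁻ a T∈

  ∈-tableaux⁺ : ∀ {a T} → positivePart a ≡ α → Diagram.Semistandard a (Diagram.filling a T) → (a , T) ∈ tableaux
  ∈-tableaux⁺ {a} {T} a⁺≡α ss = ∈-concatMap⁺ (λ a → map (a ,_) (Diagram.SSF a)) {xs = weakCompositions n α}
    (lose (∈-filter⁺ (λ a → List.≡-dec _≟_ (positivePart a) α)
      (vectors-complete _ a λ i → ∈-upTo⁺ (s≤s
        (subst (lookup a i ≤_) (trans (sum-positivePart a) (cong sum a⁺≡α)) (lookup≤sum a i)))) a⁺≡α)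
      (∈-map⁺ (a ,_) (Coding.∈-SSF⁺ a ss)))
    where
    sum-positivePart : ∀ {m} (a : Vec ℕ m) → Vec.sum a ≡ sum (positivePart a)
    sum-positivePart []          = refl
    sum-positivePart (zero ∷ a)  = sum-positivePart a
    sum-positivePart (suc x ∷ a) = cong (suc x +_) (sum-positivePart a)

  tableaux-unique : Unique tableaux
  tableaux-unique = Unique-concatMap (λ a → map (a ,_) (Diagram.SSF a)) same
    (λ {a} _ → Unique.map⁺ (λ { refl → refl }) (Coding.SSF-unique a))
    (Unique.filter⁺ (λ a → List.≡-dec _≟_ (positivePart a) α) (vectors-unique (Unique.upTo⁺ (suc (sum α))) n))
    where
    same : ∀ {a a′ z} → z ∈ map (a ,_) (Diagram.SSF a) → z ∈ map (a′ ,_) (Diagram.SSF a′) → a ≡ a′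
    same p q = trans (sym (∈-map-,⁻ p)) (∈-map-,⁻ q)

  splitting : ∀ t → Split nothing (komp t) (word t) (code t)
  splitting t = split nothing (code t)

  code-injective : ∀ {t t′} → t ∈ tableaux → t′ ∈ tableaux → code t ≡ code t′ → t ≡ t′
  code-injective {a , T} {a′ , T′} t∈ t′∈ C≡ =
    let a⁺ , ss = ∈-tableaux⁻ t∈
        a′⁺ , ss′ = ∈-tableaux⁻ t′∈
    in same-table (code-determines-shape (trans a⁺ (sym a′⁺)) ss ss′ C≡)
         (Diagram.Semistandard.s1 ss) (Diagram.Semistandard.s1 ss′) C≡
    where
    same-table : ∀ {a a′ T T′} → a ≡ a′ →
      Diagram.S1 a (Diagram.filling a T) → Diagram.S1 a′ (Diagram.filling a′ T′) →
      code (a , T) ≡ code (a′ , T′) → (a , T) ≡ (a′ , T′)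
    same-table refl s1 s1′ C≡ = cong (_ ,_) (code-determines-table s1 s1′ C≡)

  word-good : ∀ {t} → t ∈ tableaux → Good α (word t)
  word-good {a , T} t∈ =
    let a⁺≡α , ss = ∈-tableaux⁻ t∈ in
    Transfer.good a a⁺≡α (splitting (a , T)) (Coding.code-descending a F) F
      (Coding.filling⇒code a F (Diagram.Semistandard.s1 ss)) (Coding.code⇒filling a F) ss
      (λ c∈ → let d , eq , _ = Coding.code-boxed a F c∈ in d , eq)
    where
    F : Diagram.Filling a
    F = Diagram.filling a T

  -- The new glide cuts the same word into another code. Its filling can have a different shape a′,
  -- but still with positive part α, so it stays among the `tableaux`.
  realise : ∀ {t} → t ∈ tableaux → ∀ b → Parse nothing (runs (word t)) (Vec.toList b) →
    ∃ λ t′ → t′ ∈ tableaux × word t′ ≡ word t × komp t′ ≡ b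
  realise {t@(a , T)} t∈ b p =
    let C , desc , s = parse⇒split b p
          (split-noRepeat (splitting t) (Coding.code-descending a (Diagram.filling a T)))
        a′ , a′⁺≡α , T′ , ss , code≡ = Realise.realisation α-positive (word-good t∈) s desc
    in (a′ , T′) , ∈-tableaux⁺ a′⁺≡α ss ,
       trans (cong (wordFrom nothing) code≡) (proj₂ (split-functional s)) ,
       trans (cong (kompFrom nothing) code≡) (proj₁ (split-functional s))

  degree-≡ : ∀ {t} → t ∈ tableaux → degree t ≡ weight (word t) + excess (Vec.toList (komp t))
  degree-≡ {a , T} t∈ = Sizes.ex-≡ a _ (proj₂ (∈-tableaux⁻ t∈)) (splitting (a , T))

  monomial-≡ : ∀ {t} → t ∈ tableaux → monomial t ≡ Vec.map value (komp t)
  monomial-≡ {a , T} t∈ = Sizes.wt-≡ a _ (proj₂ (∈-tableaux⁻ t∈)) (splitting (a , T))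

  injective : ∀ {t t′} → t ∈ tableaux → t′ ∈ tableaux → word t ≡ word t′ → komp t ≡ komp t′ → t ≡ t′
  injective {t} {t′} t∈ t′∈ w≡ b≡ = code-injective t∈ t′∈ (split-injective (splitting t)
    (subst₂ (λ b w → Split nothing b w (code t′)) (sym b≡) (sym w≡) (splitting t′)))

  parse : ∀ {t} → t ∈ tableaux → Parse nothing (runs (word t)) (Vec.toList (komp t))
  parse {a , T} t∈ = split⇒parse (splitting (a , T)) (Coding.code-descending a (Diagram.filling a T))

  open Expansion (List.≡-dec _≟ᶜᵉ_) runs runs-positive weight degree monomial word komp tableaux tableaux-unique
    degree-≡ monomial-≡ injective parse realise public

  quasiGrothendieck-≡ : quasiGrothendieck n α ≡ poly
  quasiGrothendieck-≡ = trans (List.concatMap-cong (λ a → List.map-∘ (Diagram.SSF a)) (weakCompositions n α))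
    (sym (List.map-concatMap (λ t → term 1ℤ (degree t) (monomial t))
      (λ a → map (a ,_) (Diagram.SSF a)) (weakCompositions n α)))

theorem1p1 : (n : ℕ) → 1 ≤ n → (α : List ℕ) → IsComposition α →
    IsQuasisymmetric (quasiGrothendieck n α) ×
    (Σ (List ℕ → ℕ[β]) λ J → Σ (List (List ℕ)) λ supp →
    Unique supp × All IsComposition supp ×
    (∀ γ → γ ∉ supp → J γ ≡ []) ×
    quasiGrothendieck n α ≈ sumOver supp (λ γ → J γ · multifundamental n γ))
theorem1p1 n _ α α-positive =
  subst IsQuasisymmetric (sym quasiGrothendieck-≡) quasisymmetric ,
  subst Expands (sym quasiGrothendieck-≡) positive-expansion
  where
  open Main n α-positive
  Expands : Poly n → Set
  Expands p = Σ (List ℕ → ℕ[β]) λ J → Σ (List (List ℕ)) λ supp →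
    Unique supp × All IsComposition supp ×
    (∀ γ → γ ∉ supp → J γ ≡ []) ×
    p ≈ sumOver supp (λ γ → J γ · multifundamental n γ)
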